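{- The generating function $R(x)=\sum_{n\geq 0}|I_n(100,021)|\,x^{n+1}$ is given by $$R(x)=\frac{(1-3x)^2}{2x^2\sqrt{1-4x}}-\frac{(1-3x)(1-x)}{2x^2}.$$ Moreover, $|I_n(100,021)|=\dfrac{n^2+n+6}{2(n+3)(n+2)}\dbinom{2n+2}{n+1}$ for all $n\geq 0$.
   Context: For $n\ge 0$, $I_n$ denotes the set of inversion sequences $e=e_0e_1\cdots e_n$, i.e. integer sequences with $0\le e_i\le i$ for each $0\le i\le n$ (so elements of $I_n$ have $n+1$ letters). An inversion sequence contains a pattern (word) $\tau$ of length $k$ if it has a subsequence (not necessarily consecutive) of length $k$ that is order isomorphic to $\tau$ (same relative order, including equalities); otherwise it avoids $\tau$. $I_n(\tau_1,\dots,\tau_m)$ is the set of $e\in I_n$ avoiding all of $\tau_1,\dots,\tau_m$. Generating functions are formal power series in $x$ (the right-hand side is expanded as a Laurent series at $x=0$, with $\sqrt{\cdot}$ having constant term $1$). -}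

module Defs where

open import Algebra.Bundles using (CommutativeRing)
open import Data.Fin.Base as Fin using (Fin; zero; suc; toℕ; inject₁; opposite)
import Data.Fin.Properties as Fin
open import Data.Integer.Base as ℤ using (ℤ; +_; -[1+_])
open import Data.List.Base using (List; []; _∷_; cartesianProductWith; filter; length; upTo)
open import Data.List.Membership.Propositional using (_∈_)
open import Data.List.Membership.Propositional.Properties
  using (∈-cartesianProductWith⁺; ∈-cartesianProductWith⁻; ∈-upTo⁺; ∈-upTo⁻)
open import Data.List.Relation.Unary.All using (All; all?; []; _∷_)
open import Data.List.Relation.Unary.AllPairs using ([]; _∷_)
open import Data.List.Relation.Unary.Any using (here)
open import Data.List.Relation.Unary.Unique.Propositional using (Unique)
open import Data.List.Relation.Unary.Unique.Propositional.Properties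
  using (cartesianProductWith⁺; upTo⁺)
open import Data.Nat.Base as ℕ using (ℕ; zero; suc; _∸_)
import Data.Nat.Properties as ℕ
open import Data.Product.Base using (∃; _×_; _,_; proj₁; proj₂)
open import Data.Rational.Base as ℚ
  using (ℚ; 0ℚ; 1ℚ; ½; NonZero; 1/_)
import Data.Rational.Properties as ℚ
open import Data.Rational.Solver using (module +-*-Solver)
open import Data.Vec.Base using (Vec; []; _∷_; lookup)
import Data.Vec.Properties as Vec
open import Function.Bundles using (_⇔_; mk⇔; Equivalence)
open import Relation.Binary.PropositionalEquality
open import Relation.Nullary using (Dec; ¬_; ¬?)
open import Relation.Nullary.Decidable using (map′; _×-dec_; _→-dec_)
open import Relation.Unary using (Decidable)

open import Algebra.Properties.Semiring.Sum
  (CommutativeRing.semiring ℚ.+-*-commutativeRing)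
  using (sum; sum-cong-≗; sum-init-last; *-distribˡ-sum)

IsInversionSequence : ∀ {m} → Vec ℕ m → Set
IsInversionSequence e = ∀ i → lookup e i ℕ.≤ toℕ i

-- The words w₀ w₁ ⋯ of length m with wⱼ ≤ k + j, each listed once.
words : ∀ k m → List (Vec ℕ m)
words k zero    = [] ∷ []
words k (suc m) = cartesianProductWith _∷_ (upTo (suc k)) (words (suc k) m)

inversionSequences : ∀ n → List (Vec ℕ (suc n))
inversionSequences n = words 0 (suc n)

words-∈ : ∀ k {m} {w : Vec ℕ m} →
          w ∈ words k m ⇔ (∀ j → lookup w j ℕ.≤ k ℕ.+ toℕ j)
words-∈ k = mk⇔ (sound k) (complete k)
  where
  sound : ∀ k {m} {w : Vec ℕ m} → w ∈ words k m →
          ∀ j → lookup w j ℕ.≤ k ℕ.+ toℕ j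
  sound k {suc m} w∈ j
    with ∈-cartesianProductWith⁻ _∷_ (upTo (suc k)) (words (suc k) m) w∈
  sound k {suc m} w∈ zero | a , v , a∈ , v∈ , refl =
    subst (a ℕ.≤_) (sym (ℕ.+-identityʳ k)) (ℕ.s≤s⁻¹ (∈-upTo⁻ a∈))
  sound k {suc m} w∈ (suc j) | a , v , a∈ , v∈ , refl =
    subst (lookup v j ℕ.≤_) (sym (ℕ.+-suc k (toℕ j))) (sound (suc k) v∈ j)

  complete : ∀ k {m} {w : Vec ℕ m} →
             (∀ j → lookup w j ℕ.≤ k ℕ.+ toℕ j) → w ∈ words k m
  complete k {w = []}    w≤ = here refl
  complete k {w = a ∷ v} w≤ = ∈-cartesianProductWith⁺ _∷_
    (∈-upTo⁺ (ℕ.s≤s (subst (a ℕ.≤_) (ℕ.+-identityʳ k) (w≤ zero))))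
    (complete (suc k)
      λ j → subst (lookup v j ℕ.≤_) (ℕ.+-suc k (toℕ j)) (w≤ (suc j)))

words-unique : ∀ k m → Unique (words k m)
words-unique k zero    = [] ∷ []
words-unique k (suc m) =
  cartesianProductWith⁺ _∷_ Vec.∷-injective (upTo⁺ (suc k)) (words-unique (suc k) m)

inversionSequences-∈ : ∀ n {e : Vec ℕ (suc n)} →
                       e ∈ inversionSequences n ⇔ IsInversionSequence e
inversionSequences-∈ n = words-∈ 0

inversionSequences-unique : ∀ n → Unique (inversionSequences n)
inversionSequences-unique n = words-unique 0 (suc n)

StrictlyIncreasing : ∀ {k m} → Vec (Fin m) k → Set
StrictlyIncreasing p = ∀ a b → a Fin.< b → lookup p a Fin.< lookup p b

OrderIsomorphic : ∀ {k} → (Fin k → ℕ) → (Fin k → ℕ) → Set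
OrderIsomorphic u v =
  ∀ a b → (u a ℕ.< u b ⇔ v a ℕ.< v b) × (u a ≡ u b ⇔ v a ≡ v b)

-- p lists the positions of the subsequence.
Contains : ∀ {k m} → Vec ℕ k → Vec ℕ m → Set
Contains {k} {m} τ e = ∃ λ (p : Vec (Fin m) k) →
  StrictlyIncreasing p ×
  OrderIsomorphic (λ a → lookup e (lookup p a)) (lookup τ)

Avoids : ∀ {k m} → Vec ℕ k → Vec ℕ m → Set
Avoids τ e = ¬ Contains τ e

_⇔-dec_ : ∀ {A B : Set} → Dec A → Dec B → Dec (A ⇔ B)
a? ⇔-dec b? = map′ (λ (f , g) → mk⇔ f g)
                   (λ e → Equivalence.to e , Equivalence.from e)
                   ((a? →-dec b?) ×-dec (b? →-dec a?))

anyVec? : ∀ {m} k {P : Vec (Fin m) k → Set} → Decidable P → Dec (∃ P)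
anyVec? zero    P? = map′ ([] ,_) (λ { ([] , h) → h }) (P? [])
anyVec? (suc k) P? =
  map′ (λ (i , v , h) → i ∷ v , h) (λ { (i ∷ v , h) → i , v , h })
       (Fin.any? λ i → anyVec? k λ v → P? (i ∷ v))

contains? : ∀ {k m} (τ : Vec ℕ k) (e : Vec ℕ m) → Dec (Contains τ e)
contains? {k} τ e = anyVec? k λ p →
  (Fin.all? λ a → Fin.all? λ b →
    (a Fin.<? b) →-dec (lookup p a Fin.<? lookup p b))
  ×-dec
  (Fin.all? λ a → Fin.all? λ b →
    ((lookup e (lookup p a) ℕ.<? lookup e (lookup p b))
      ⇔-dec (lookup τ a ℕ.<? lookup τ b))
    ×-dec
    ((lookup e (lookup p a) ℕ.≟ lookup e (lookup p b))
      ⇔-dec (lookup τ a ℕ.≟ lookup τ b)))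

avoidsAll? : ∀ {k m} (τs : List (Vec ℕ k)) →
             Decidable (λ (e : Vec ℕ m) → All (λ τ → Avoids τ e) τs)
avoidsAll? τs e = all? (λ τ → ¬? (contains? τ e)) τs

I : ∀ {k} (n : ℕ) → List (Vec ℕ k) → List (Vec ℕ (suc n))
I n τs = filter (avoidsAll? τs) (inversionSequences n)

∣I∣ : ∀ {k} → ℕ → List (Vec ℕ k) → ℕ
∣I∣ n τs = length (I n τs)

fromℕ : ℕ → ℚ
fromℕ n = + n ℚ./ 1

-- A formal power series is the sequence of its coefficients.
PowerSeries : Set
PowerSeries = ℕ → ℚ

#_ : ℕ → PowerSeries
(# c) zero    = fromℕ c
(# c) (suc _) = 0ℚ

X : PowerSeries
X zero          = 0ℚ
X (suc zero)    = 1ℚ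
X (suc (suc _)) = 0ℚ

infix  9 #_
infix  8 _²
infixl 7 _⊛_
infixl 6 _⊖_

_⊖_ : PowerSeries → PowerSeries → PowerSeries
(f ⊖ g) n = f n ℚ.- g n

_⊛_ : PowerSeries → PowerSeries → PowerSeries
(f ⊛ g) n = sum {suc n} λ i → f (toℕ i) ℚ.* g (n ∸ toℕ i)

_² : PowerSeries → PowerSeries
f ² = f ⊛ f

-- Course-of-values recursion: history n is aₙ₋₁ ∷ ⋯ ∷ a₁ ∷ a₀ ∷ [],
-- where aₙ = step n (history n).
module CourseOfValues {A : Set} (step : ∀ n → Vec A n → A) where

  history : ∀ n → Vec A n
  history zero    = []
  history (suc n) = step n (history n) ∷ history n

  value : ℕ → A
  value n = step n (history n)

  lookup-history : ∀ n i → lookup (history n) i ≡ value (n ∸ suc (toℕ i))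
  lookup-history (suc n) zero    = refl
  lookup-history (suc n) (suc i) = lookup-history n i

-- The multiplicative inverse of g, by solving g ⊛ h = 1 for one
-- coefficient of h at a time.
module Inverse (g : PowerSeries) .{{_ : NonZero (g 0)}} where

  step : ∀ n → Vec ℚ n → ℚ
  step zero    _ = 1/ g 0
  step (suc n) h = ℚ.- (1/ g 0 ℚ.* sum λ i → g (suc (toℕ i)) ℚ.* lookup h i)

  open CourseOfValues step public

inverse : (g : PowerSeries) → .{{_ : NonZero (g 0)}} → PowerSeries
inverse g = Inverse.value g

-- The square root with constant term 1, for f with constant term 1, by
-- solving s ⊛ s = f for one coefficient of s at a time.  The constant
-- term of f is not inspected.
module SquareRoot (f : PowerSeries) where

  step : ∀ n → Vec ℚ n → ℚ
  step zero    _ = 1ℚ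
  step (suc n) s = ½ ℚ.* (f (suc n) ℚ.-
    sum {n} λ i → lookup s (inject₁ (opposite i)) ℚ.* lookup s (inject₁ i))

  open CourseOfValues step public

√ : PowerSeries → PowerSeries
√ f = SquareRoot.value f

-- x^ d · f is x to the power d times the power series f; the constant
-- term of f may vanish, so this presentation is not unique.
infix 5 x^_·_
record LaurentSeries : Set where
  constructor x^_·_
  field
    order  : ℤ
    series : PowerSeries

open LaurentSeries

coeff : LaurentSeries → ℤ → ℚ
coeff (x^ d · f) k with k ℤ.- d
... | + n      = f n
... | -[1+ _ ] = 0ℚ

infix 4 _≈ᴸ_
_≈ᴸ_ : LaurentSeries → LaurentSeries → Set
F ≈ᴸ G = ∀ k → coeff F k ≡ coeff G k

infixl 6 _⊖ᴸ_
_⊖ᴸ_ : LaurentSeries → LaurentSeries → LaurentSeries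
F ⊖ᴸ G = x^ m · λ n → coeff F (m ℤ.+ + n) ℚ.- coeff G (m ℤ.+ + n)
  where m = order F ℤ.⊓ order G

infixl 7 _⊘_
_⊘_ : (F G : LaurentSeries) → .{{NonZero (series G 0)}} → LaurentSeries
F ⊘ G = x^ order F ℤ.- order G · series F ⊛ inverse (series G)

inverse-correct : ∀ g → .{{_ : NonZero (g 0)}} → g ⊛ inverse g ≗ # 1
inverse-correct g zero    = trans (ℚ.+-identityʳ _) (ℚ.*-inverseʳ (g 0))
inverse-correct g (suc n) = begin
  g 0 ℚ.* (ℚ.- (1/ g 0 ℚ.* sum t)) ℚ.+ sum t′
    ≡⟨ cong (λ s → g 0 ℚ.* (ℚ.- (1/ g 0 ℚ.* s)) ℚ.+ sum t′) (sum-cong-≗ t≗t′) ⟩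
  g 0 ℚ.* (ℚ.- (1/ g 0 ℚ.* sum t′)) ℚ.+ sum t′
    ≡⟨ rearrange (g 0) (1/ g 0) (sum t′) ⟩
  (1ℚ ℚ.- g 0 ℚ.* 1/ g 0) ℚ.* sum t′
    ≡⟨ cong (λ u → (1ℚ ℚ.- u) ℚ.* sum t′) (ℚ.*-inverseʳ (g 0)) ⟩
  0ℚ ℚ.* sum t′
    ≡⟨ ℚ.*-zeroˡ (sum t′) ⟩
  0ℚ ∎
  where
  open ≡-Reasoning
  t t′ : Fin (suc n) → ℚ
  t  i = g (suc (toℕ i)) ℚ.* lookup (Inverse.history g (suc n)) i
  t′ i = g (suc (toℕ i)) ℚ.* inverse g (n ∸ toℕ i)
  t≗t′ : t ≗ t′
  t≗t′ i = cong (g (suc (toℕ i)) ℚ.*_) (Inverse.lookup-history g (suc n) i)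
  rearrange : ∀ a b s → a ℚ.* (ℚ.- (b ℚ.* s)) ℚ.+ s ≡ (1ℚ ℚ.- a ℚ.* b) ℚ.* s
  rearrange = +-*-Solver.solve 3
    (λ a b s → a :* (:- (b :* s)) :+ s := (con 1ℚ :- a :* b) :* s) refl
    where open +-*-Solver

√-constant : ∀ f → √ f 0 ≡ 1ℚ
√-constant f = refl

√-correct : ∀ f → f 0 ≡ 1ℚ → √ f ² ≗ f
√-correct f f₀ zero    = sym f₀
√-correct f f₀ (suc n) = begin
  1ℚ ℚ.* √ f (suc n) ℚ.+ sum u
    ≡⟨ cong (1ℚ ℚ.* √ f (suc n) ℚ.+_) (sum-init-last u) ⟩
  1ℚ ℚ.* √ f (suc n) ℚ.+ (sum (λ i → u (inject₁ i)) ℚ.+ u (Fin.fromℕ n))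
    ≡⟨ cong₂ (λ a b → 1ℚ ℚ.* √ f (suc n) ℚ.+ (a ℚ.+ b)) (sym (sum-cong-≗ t≗u)) u-last ⟩
  1ℚ ℚ.* (½ ℚ.* (f (suc n) ℚ.- sum t)) ℚ.+ (sum t ℚ.+ ½ ℚ.* (f (suc n) ℚ.- sum t) ℚ.* 1ℚ)
    ≡⟨ rearrange (f (suc n)) (sum t) ⟩
  f (suc n) ∎
  where
  open ≡-Reasoning
  h : Vec ℚ (suc n)
  h = SquareRoot.history f (suc n)
  t : Fin n → ℚ
  t i = lookup h (inject₁ (opposite i)) ℚ.* lookup h (inject₁ i)
  u : Fin (suc n) → ℚ
  u i = √ f (suc (toℕ i)) ℚ.* √ f (n ∸ toℕ i)
  index : ∀ i → n ∸ toℕ (inject₁ (opposite i)) ≡ suc (toℕ (inject₁ i))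
  index i = begin
    n ∸ toℕ (inject₁ (opposite i)) ≡⟨ cong (n ∸_) (Fin.toℕ-inject₁ (opposite i)) ⟩
    n ∸ toℕ (opposite i)           ≡⟨ cong (n ∸_) (Fin.opposite-prop i) ⟩
    n ∸ (n ∸ suc (toℕ i))          ≡⟨ ℕ.m∸[m∸n]≡n (Fin.toℕ<n i) ⟩
    suc (toℕ i)                    ≡⟨ cong suc (Fin.toℕ-inject₁ i) ⟨
    suc (toℕ (inject₁ i))          ∎
  t≗u : t ≗ λ i → u (inject₁ i)
  t≗u i = cong₂ ℚ._*_
    (trans (SquareRoot.lookup-history f (suc n) (inject₁ (opposite i)))
           (cong (√ f) (index i)))
    (SquareRoot.lookup-history f (suc n) (inject₁ i))
  u-last : u (Fin.fromℕ n) ≡ √ f (suc n) ℚ.* 1ℚ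
  u-last = cong₂ (λ a b → √ f (suc a) ℚ.* √ f b) (Fin.toℕ-fromℕ n)
    (trans (cong (n ∸_) (Fin.toℕ-fromℕ n)) (ℕ.n∸n≡0 n))
  rearrange : ∀ a s →
    1ℚ ℚ.* (½ ℚ.* (a ℚ.- s)) ℚ.+ (s ℚ.+ ½ ℚ.* (a ℚ.- s) ℚ.* 1ℚ) ≡ a
  rearrange = +-*-Solver.solve 2
    (λ a s → con 1ℚ :* (con ½ :* (a :- s)) :+ (s :+ con ½ :* (a :- s) :* con 1ℚ) := a)
    refl
    where open +-*-Solver

{-# OPTIONS --safe #-}
module Submission where

-- An inversion sequence is 0w, since its first letter is 0.  It avoids 021
-- iff its positive letters increase weakly: two positive letters in
-- decreasing order would form 021 together with the leading 0.  Given this, it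
-- avoids 100 iff at most one letter 0 comes after a positive letter.  So the
-- condition on w (Admissible) can be checked while reading w from left to right,
-- and the state consists of the last positive letter and whether a 0 has
-- come after a positive letter.
--
-- Counting by the first letter gives recurrences for the number of words that
-- lead from each state to acceptance.  Their solutions are ballot numbers,
-- plus multiples of binomial coefficients for the words with a late 0; each
-- solution is verified with Pascal's rule.  The outcome (∣I∣-binomial) is
-- |I_n(100,021)| = p₀ - p₁ + p₂, where pⱼ = C(2n+1, n+1+j).  The ratios of
-- p₀, p₁, p₂ give the closed formula (∣I∣-closed).  Pascal's rule also writes
-- the central binomial coefficients C(2k,k) for k = n+1, n+2, n+3 as linear
-- combinations of p₀, p₁, p₂, which yields (∣I∣-central)
--   2 |I_n(100,021)| = C(2n+6,n+3) - 6 C(2n+4,n+2) + 9 C(2n+2,n+1).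
--
-- The right-hand side of the last equation is the coefficient of x^(n+3) in
-- (1 - 3x)² / √(1 - 4x), once 1/√(1 - 4x) is known to generate the central
-- binomial coefficients.  To see this, let S be the square root of F = 1 - 4x
-- and T its inverse.  Applying θ = x d/dx to S² = F and ST = 1 gives
-- θ(F) T + 2 F θ(T) = 0 (inverse-√-ode), which on coefficients is the recurrence
-- of the central binomial coefficients.  The polynomial (1 - 3x)(1 - x) cancels
-- the coefficients of 1, x and x².

open import Defs
open import Algebra.Bundles using (CommutativeRing)
open import Data.Fin.Base as Fin using (Fin; zero; suc; toℕ)
open import Data.Fin.Properties using (toℕ≤pred[n])
import Data.Integer.Base as ℤ
import Data.Integer.Properties as ℤ
open import Data.List.Base as List
  using (List; []; _∷_; _++_; applyUpTo; cartesianProductWith; filter; length; upTo)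
open import Data.List.Properties
  using (filter-++; filter-none; filter-≐; length-++; map-upTo; ++-identityʳ)
open import Data.List.Relation.Unary.All as All using (All; []; _∷_)
open import Data.Nat.Base
  using (ℕ; zero; suc; _+_; _*_; _∸_; _≤_; _<_; z≤n; s≤s; s≤s⁻¹; z<s; s<s; s<s⁻¹; NonZero)
open import Data.Nat.Combinatorics
  using (_C_; nCk+nC[k+1]≡[n+1]C[k+1]; nCk≡nC[n∸k]; nCn≡1; k>n⇒nCk≡0)
open import Data.Nat.ListAction renaming (sum to sumℕ) using ()
open import Data.Nat.Properties
open import Data.Nat.Tactic.RingSolver using (solve-∀)
open import Data.Product.Base using (_×_; _,_; proj₁; proj₂)
open import Data.Rational.Base as ℚ using (ℚ; 0ℚ; 1ℚ; ½)
import Data.Rational.Properties as ℚ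
open import Data.Rational.Solver using (module +-*-Solver)
import Data.Rational.Unnormalised.Base as ℚᵘ
import Data.Rational.Unnormalised.Properties as ℚᵘ
open import Data.Unit.Base using (⊤; tt)
open import Data.Vec.Base using (Vec; []; _∷_; lookup)
open import Function.Base using (_∘_)
open import Function.Bundles using (_⇔_; mk⇔; Equivalence)
import Relation.Binary.Reasoning.Setoid ℚᵘ.≃-setoid as ≃-Reasoning
open import Relation.Binary.PropositionalEquality
open import Relation.Nullary using (yes; no; ¬_; contradiction)
open import Relation.Nullary.Decidable using (_×-dec_)
open import Relation.Unary using (Decidable; _≐_)

open import Algebra.Properties.Semiring.Sum
  (CommutativeRing.semiring ℚ.+-*-commutativeRing)
  using (sum; sum-cong-≗; ∑-distrib-+; *-distribˡ-sum)
open +-*-Solver using (solve; _:+_; _:*_; _:-_; :-_; _:=_; con)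

-- Avoidance of 100 and 021 letter by letter

-- w increases weakly and all its letters are at least v.
Ascending : ∀ {m} → ℕ → Vec ℕ m → Set
Ascending v []      = ⊤
Ascending v (a ∷ w) = v ≤ a × Ascending a w

-- For v > 0, w is obtained from a word that is Ascending v by inserting at
-- most one letter 0.
AscendingUpToZero : ∀ {m} → ℕ → Vec ℕ m → Set
AscendingUpToZero v []          = ⊤
AscendingUpToZero v (zero  ∷ w) = Ascending v w
AscendingUpToZero v (suc a ∷ w) = v ≤ suc a × AscendingUpToZero (suc a) w

-- The positive letters of w increase weakly, and at most one letter 0
-- comes after a positive letter.
Admissible : ∀ {m} → Vec ℕ m → Set
Admissible []          = ⊤
Admissible (zero  ∷ w) = Admissible w
Admissible (suc a ∷ w) = AscendingUpToZero (suc a) w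

ascending? : ∀ {m} v → Decidable (Ascending {m} v)
ascending? v []      = yes tt
ascending? v (a ∷ w) = (v ≤? a) ×-dec ascending? a w

ascendingUpToZero? : ∀ {m} v → Decidable (AscendingUpToZero {m} v)
ascendingUpToZero? v []          = yes tt
ascendingUpToZero? v (zero  ∷ w) = ascending? v w
ascendingUpToZero? v (suc a ∷ w) = (v ≤? suc a) ×-dec ascendingUpToZero? (suc a) w

admissible? : ∀ {m} → Decidable (Admissible {m})
admissible? []          = yes tt
admissible? (zero  ∷ w) = admissible? w
admissible? (suc a ∷ w) = ascendingUpToZero? (suc a) w

-- The letters of w never descend to a positive letter.  When w starts with
-- 0 this is avoidance of 021.
Monotone⁺ : ∀ {m} → Vec ℕ m → Set
Monotone⁺ w = ∀ i j → i Fin.< j → 0 < lookup w j → lookup w i ≤ lookup w j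

AtMostOneZero : ∀ {m} → Vec ℕ m → Set
AtMostOneZero w = ∀ i j → i Fin.< j → lookup w i ≡ 0 → ¬ lookup w j ≡ 0

-- At most one letter 0 comes after a positive letter.  For words that are
-- Monotone⁺ this is avoidance of 100.
AtMostOneLateZero : ∀ {m} → Vec ℕ m → Set
AtMostOneLateZero w = ∀ i j k → i Fin.< j → j Fin.< k →
  0 < lookup w i → lookup w j ≡ 0 → ¬ lookup w k ≡ 0

monotone⁺-tail : ∀ {m} a (w : Vec ℕ m) → Monotone⁺ (a ∷ w) → Monotone⁺ w
monotone⁺-tail a w mono i j i<j = mono (suc i) (suc j) (s<s i<j)

ascending-intro : ∀ {m v} (w : Vec ℕ m) → 0 < v →
                  (∀ i → v ≤ lookup w i) → Monotone⁺ w → Ascending v w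
ascending-intro []    0<v v≤ mono = tt
ascending-intro (a ∷ w) 0<v v≤ mono = v≤ zero ,
  ascending-intro w (<-≤-trans 0<v (v≤ zero))
    (λ i → mono zero (suc i) z<s (<-≤-trans 0<v (v≤ (suc i))))
    (monotone⁺-tail _ w mono)

ascendingUpToZero-intro : ∀ {m v} (w : Vec ℕ m) → 0 < v →
  (∀ i → 0 < lookup w i → v ≤ lookup w i) → Monotone⁺ w → AtMostOneZero w →
  AscendingUpToZero v w
ascendingUpToZero-intro []        0<v v≤ mono one = tt
ascendingUpToZero-intro (zero  ∷ w) 0<v v≤ mono one =
  ascending-intro w 0<v
    (λ i → v≤ (suc i) (n≢0⇒n>0 (one zero (suc i) z<s refl)))
    (monotone⁺-tail _ w mono)
ascendingUpToZero-intro (suc a ∷ w) 0<v v≤ mono one = v≤ zero z<s ,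
  ascendingUpToZero-intro w z<s
    (λ i → mono zero (suc i) z<s)
    (monotone⁺-tail _ w mono)
    (λ i j i<j → one (suc i) (suc j) (s<s i<j))

admissible-intro : ∀ {m} (w : Vec ℕ m) →
                   Monotone⁺ w → AtMostOneLateZero w → Admissible w
admissible-intro []        mono late = tt
admissible-intro (zero  ∷ w) mono late =
  admissible-intro w (monotone⁺-tail _ w mono)
    (λ i j k i<j j<k → late (suc i) (suc j) (suc k) (s<s i<j) (s<s j<k))
admissible-intro (suc a ∷ w) mono late =
  ascendingUpToZero-intro w z<s
    (λ i → mono zero (suc i) z<s)
    (monotone⁺-tail _ w mono)
    (λ i j i<j → late zero (suc i) (suc j) z<s (s<s i<j) z<s)

monotone⁺-∷ : ∀ {m a} (w : Vec ℕ m) → (∀ i → 0 < lookup w i → a ≤ lookup w i) →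
              Monotone⁺ w → Monotone⁺ (a ∷ w)
monotone⁺-∷ w a≤ mono zero    (suc j) i<j = a≤ j
monotone⁺-∷ w a≤ mono (suc i) (suc j) i<j = mono i j (s<s⁻¹ i<j)

ascending-≤ : ∀ {m v} (w : Vec ℕ m) → Ascending v w → ∀ i → v ≤ lookup w i
ascending-≤ (a ∷ w) (v≤a , asc) zero    = v≤a
ascending-≤ (a ∷ w) (v≤a , asc) (suc i) = ≤-trans v≤a (ascending-≤ w asc i)

ascending-monotone⁺ : ∀ {m v} (w : Vec ℕ m) → Ascending v w → Monotone⁺ w
ascending-monotone⁺ (a ∷ w) (v≤a , asc) =
  monotone⁺-∷ w (λ i _ → ascending-≤ w asc i) (ascending-monotone⁺ w asc)

ascendingUpToZero-≤ : ∀ {m v} (w : Vec ℕ m) → AscendingUpToZero v w →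
                      ∀ i → 0 < lookup w i → v ≤ lookup w i
ascendingUpToZero-≤ (zero  ∷ w) asc         (suc i) _  = ascending-≤ w asc i
ascendingUpToZero-≤ (suc a ∷ w) (v≤a , asc) zero    _  = v≤a
ascendingUpToZero-≤ (suc a ∷ w) (v≤a , asc) (suc i) 0< =
  ≤-trans v≤a (ascendingUpToZero-≤ w asc i 0<)

ascendingUpToZero-monotone⁺ : ∀ {m v} (w : Vec ℕ m) →
                              AscendingUpToZero v w → Monotone⁺ w
ascendingUpToZero-monotone⁺ (zero  ∷ w) asc         =
  monotone⁺-∷ w (λ _ _ → z≤n) (ascending-monotone⁺ w asc)
ascendingUpToZero-monotone⁺ (suc a ∷ w) (v≤a , asc) =
  monotone⁺-∷ w (ascendingUpToZero-≤ w asc) (ascendingUpToZero-monotone⁺ w asc)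

ascendingUpToZero-zeros : ∀ {m v} (w : Vec ℕ m) → 0 < v →
                          AscendingUpToZero v w → AtMostOneZero w
ascendingUpToZero-zeros (zero  ∷ w) 0<v asc zero (suc j) _ _ wⱼ≡0 =
  n≮0 (subst (0 <_) wⱼ≡0 (<-≤-trans 0<v (ascending-≤ w asc j)))
ascendingUpToZero-zeros (zero  ∷ w) 0<v asc (suc i) _ _ wᵢ≡0 _ =
  n≮0 (subst (0 <_) wᵢ≡0 (<-≤-trans 0<v (ascending-≤ w asc i)))
ascendingUpToZero-zeros (suc a ∷ w) 0<v (_ , asc) (suc i) (suc j) i<j =
  ascendingUpToZero-zeros w z<s asc i j (s<s⁻¹ i<j)

admissible-monotone⁺ : ∀ {m} (w : Vec ℕ m) → Admissible w → Monotone⁺ w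
admissible-monotone⁺ (zero  ∷ w) adm =
  monotone⁺-∷ w (λ _ _ → z≤n) (admissible-monotone⁺ w adm)
admissible-monotone⁺ (suc a ∷ w) adm =
  monotone⁺-∷ w (ascendingUpToZero-≤ w adm) (ascendingUpToZero-monotone⁺ w adm)

admissible-zeros : ∀ {m} (w : Vec ℕ m) → Admissible w → AtMostOneLateZero w
admissible-zeros (zero  ∷ w) adm (suc i) (suc j) (suc k) i<j j<k =
  admissible-zeros w adm i j k (s<s⁻¹ i<j) (s<s⁻¹ j<k)
admissible-zeros (suc a ∷ w) adm i (suc j) (suc k) i<j j<k _ =
  ascendingUpToZero-zeros w z<s adm j k (s<s⁻¹ j<k)

-- The relation that OrderIsomorphic imposes on each pair of positions.
SameOrder : (x y x′ y′ : ℕ) → Set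
SameOrder x y x′ y′ = (x < y ⇔ x′ < y′) × (x ≡ y ⇔ x′ ≡ y′)

module _ {x y x′ y′ : ℕ} where

  both-< : x < y → x′ < y′ → SameOrder x y x′ y′
  both-< p q = mk⇔ (λ _ → q) (λ _ → p) ,
    mk⇔ (λ r → contradiction p (<-irrefl r)) (λ r → contradiction q (<-irrefl r))

  both-> : y < x → y′ < x′ → SameOrder x y x′ y′
  both-> p q =
    mk⇔ (λ r → contradiction p (<-asym r)) (λ r → contradiction q (<-asym r)) ,
    mk⇔ (λ r → contradiction p (<-irrefl (sym r))) (λ r → contradiction q (<-irrefl (sym r)))

  both-≡ : x ≡ y → x′ ≡ y′ → SameOrder x y x′ y′
  both-≡ p q = mk⇔ (contradiction p ∘ <⇒≢) (contradiction q ∘ <⇒≢) ,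
    mk⇔ (λ _ → q) (λ _ → p)

increasing₃ : ∀ {m} {i j k : Fin m} → i Fin.< j → j Fin.< k →
              StrictlyIncreasing (i ∷ j ∷ k ∷ [])
increasing₃ i<j j<k zero zero ()
increasing₃ i<j j<k zero (suc zero) _ = i<j
increasing₃ i<j j<k zero (suc (suc zero)) _ = <-trans i<j j<k
increasing₃ i<j j<k (suc zero) (suc zero) (s≤s ())
increasing₃ i<j j<k (suc zero) (suc (suc zero)) _ = j<k
increasing₃ i<j j<k (suc (suc zero)) (suc zero) (s≤s ())
increasing₃ i<j j<k (suc (suc zero)) (suc (suc zero)) (s≤s (s≤s ()))

contains-100⁺ : ∀ {m} (e : Vec ℕ m) {i j k} → i Fin.< j → j Fin.< k →
  lookup e j < lookup e i → lookup e j ≡ lookup e k → Contains (1 ∷ 0 ∷ 0 ∷ []) e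
contains-100⁺ e {i} {j} {k} i<j j<k ej<ei ej≡ek =
  i ∷ j ∷ k ∷ [] , increasing₃ i<j j<k , iso
  where
  iso : OrderIsomorphic (λ a → lookup e (lookup (i ∷ j ∷ k ∷ []) a))
                        (lookup (1 ∷ 0 ∷ 0 ∷ []))
  iso zero             zero             = both-≡ refl refl
  iso zero             (suc zero)       = both-> ej<ei z<s
  iso zero             (suc (suc zero)) = both-> (subst (_< _) ej≡ek ej<ei) z<s
  iso (suc zero)       zero             = both-< ej<ei z<s
  iso (suc zero)       (suc zero)       = both-≡ refl refl
  iso (suc zero)       (suc (suc zero)) = both-≡ ej≡ek refl
  iso (suc (suc zero)) zero             = both-< (subst (_< _) ej≡ek ej<ei) z<s
  iso (suc (suc zero)) (suc zero)       = both-≡ (sym ej≡ek) refl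
  iso (suc (suc zero)) (suc (suc zero)) = both-≡ refl refl

contains-021⁺ : ∀ {m} (e : Vec ℕ m) {i j k} → i Fin.< j → j Fin.< k →
  lookup e i < lookup e k → lookup e k < lookup e j → Contains (0 ∷ 2 ∷ 1 ∷ []) e
contains-021⁺ e {i} {j} {k} i<j j<k ei<ek ek<ej =
  i ∷ j ∷ k ∷ [] , increasing₃ i<j j<k , iso
  where
  iso : OrderIsomorphic (λ a → lookup e (lookup (i ∷ j ∷ k ∷ []) a))
                        (lookup (0 ∷ 2 ∷ 1 ∷ []))
  iso zero             zero             = both-≡ refl refl
  iso zero             (suc zero)       = both-< (<-trans ei<ek ek<ej) z<s
  iso zero             (suc (suc zero)) = both-< ei<ek z<s
  iso (suc zero)       zero             = both-> (<-trans ei<ek ek<ej) z<s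
  iso (suc zero)       (suc zero)       = both-≡ refl refl
  iso (suc zero)       (suc (suc zero)) = both-> ek<ej (s<s z<s)
  iso (suc (suc zero)) zero             = both-> ei<ek z<s
  iso (suc (suc zero)) (suc zero)       = both-< ek<ej (s<s z<s)
  iso (suc (suc zero)) (suc (suc zero)) = both-≡ refl refl

-- The patterns 100 and 021.  As a pattern synonym this is expanded before type
-- checking, so that ∣I∣ n patterns is never evaluated to compare it with its
-- expansion.
pattern patterns = (1 ∷ 0 ∷ 0 ∷ []) ∷ (0 ∷ 2 ∷ 1 ∷ []) ∷ []

avoids⇒admissible : ∀ {m} (w : Vec ℕ m) →
                    All (λ τ → Avoids τ (0 ∷ w)) patterns → Admissible w
avoids⇒admissible w (avoids-100 ∷ avoids-021 ∷ []) = admissible-intro w mono late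
  where
  mono : Monotone⁺ w
  mono i j i<j 0<wⱼ = ≮⇒≥ λ wⱼ<wᵢ →
    avoids-021 (contains-021⁺ (0 ∷ w) {zero} {suc i} {suc j} z<s (s<s i<j) 0<wⱼ wⱼ<wᵢ)
  late : AtMostOneLateZero w
  late i j k i<j j<k 0<wᵢ wⱼ≡0 wₖ≡0 = avoids-100
    (contains-100⁺ (0 ∷ w) {suc i} {suc j} {suc k} (s<s i<j) (s<s j<k)
      (subst (_< lookup w i) (sym wⱼ≡0) 0<wᵢ) (trans wⱼ≡0 (sym wₖ≡0)))

admissible⇒avoids : ∀ {m} (w : Vec ℕ m) →
                    Admissible w → All (λ τ → Avoids τ (0 ∷ w)) patterns
admissible⇒avoids w adm = avoids-100 ∷ avoids-021 ∷ []
  where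
  mono : Monotone⁺ (0 ∷ w)
  mono = monotone⁺-∷ w (λ _ _ → z≤n) (admissible-monotone⁺ w adm)

  late : AtMostOneLateZero (0 ∷ w)
  late = admissible-zeros (0 ∷ w) adm

  avoids-100 : Avoids (1 ∷ 0 ∷ 0 ∷ []) (0 ∷ w)
  avoids-100 (i ∷ j ∷ k ∷ [] , increasing , iso) =
    late i j k i<j j<k (≤-<-trans z≤n eⱼ<eᵢ) eⱼ≡0 (trans (sym eⱼ≡eₖ) eⱼ≡0)
    where
    i<j   = increasing zero (suc zero) z<s
    j<k   = increasing (suc zero) (suc (suc zero)) (s<s z<s)
    eⱼ<eᵢ = Equivalence.from (proj₁ (iso (suc zero) zero)) z<s
    eⱼ≡eₖ = Equivalence.from (proj₂ (iso (suc zero) (suc (suc zero)))) refl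
    eⱼ≡0 : lookup (0 ∷ w) j ≡ 0
    eⱼ≡0 = n≤0⇒n≡0 (≮⇒≥ λ 0<eⱼ → <⇒≱ eⱼ<eᵢ (mono i j i<j 0<eⱼ))

  avoids-021 : Avoids (0 ∷ 2 ∷ 1 ∷ []) (0 ∷ w)
  avoids-021 (i ∷ j ∷ k ∷ [] , increasing , iso) =
    <⇒≱ eₖ<eⱼ (mono j k j<k (≤-<-trans z≤n eᵢ<eₖ))
    where
    j<k   = increasing (suc zero) (suc (suc zero)) (s<s z<s)
    eᵢ<eₖ = Equivalence.from (proj₁ (iso zero (suc (suc zero)))) z<s
    eₖ<eⱼ = Equivalence.from (proj₁ (iso (suc (suc zero)) (suc zero))) (s<s z<s)

-- Words counted by their first letter

count : {A : Set} {P : A → Set} → Decidable P → List A → ℕ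
count P? xs = length (filter P? xs)

module _ {A : Set} {P Q : A → Set} (P? : Decidable P) (Q? : Decidable Q) where

  count-≐ : P ≐ Q → ∀ xs → count P? xs ≡ count Q? xs
  count-≐ P≐Q xs = cong length (filter-≐ P? Q? P≐Q xs)

module _ {A : Set} {P : A → Set} (P? : Decidable P) where

  count-none : (∀ {x} → ¬ P x) → ∀ xs → count P? xs ≡ 0
  count-none ¬P xs = cong length (filter-none P? (All.universal (λ _ → ¬P) xs))

  count-++ : ∀ xs ys → count P? (xs ++ ys) ≡ count P? xs + count P? ys
  count-++ xs ys = trans (cong length (filter-++ P? xs ys)) (length-++ (filter P? xs))

  count-map : {B : Set} (f : B → A) → ∀ xs → count P? (List.map f xs) ≡ count (P? ∘ f) xs
  count-map f []       = refl
  count-map f (x ∷ xs) with P? (f x)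
  ... | yes _ = cong suc (count-map f xs)
  ... | no  _ = count-map f xs

  count-product : {B C : Set} (f : B → C → A) → ∀ xs ys →
    count P? (cartesianProductWith f xs ys) ≡ sumℕ (List.map (λ x → count (P? ∘ f x) ys) xs)
  count-product f []       ys = refl
  count-product f (x ∷ xs) ys =
    trans (count-++ (List.map (f x) ys) (cartesianProductWith f xs ys))
          (cong₂ _+_ (count-map (f x) ys) (count-product f xs ys))

count-words : ∀ k m {P : Vec ℕ (suc m) → Set} (P? : Decidable P) →
  count P? (words k (suc m)) ≡
  sumℕ (applyUpTo (λ a → count (P? ∘ (a ∷_)) (words (suc k) m)) (suc k))
count-words k m P? = trans (count-product P? _∷_ (upTo (suc k)) (words (suc k) m))
  (cong sumℕ (map-upTo (λ a → count (P? ∘ (a ∷_)) (words (suc k) m)) (suc k)))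

-- Σ< n f = f 0 + ⋯ + f (n - 1).
Σ< : ℕ → (ℕ → ℕ) → ℕ
Σ< zero    f = 0
Σ< (suc n) f = f n + Σ< n f

-- A sum whose first v terms vanish, read backwards.  It turns a sum over the
-- value a of a letter, with v ≤ a ≤ v + d, into a sum over v + d - a.
sumℕ-reverse : ∀ v d {f g : ℕ → ℕ} →
  (∀ a → a < v → f a ≡ 0) → (∀ b → b ≤ d → f (v + b) ≡ g (d ∸ b)) →
  sumℕ (applyUpTo f (suc (v + d))) ≡ Σ< (suc d) g
sumℕ-reverse (suc v) d f≡0 f≡g = cong₂ _+_ (f≡0 0 z<s)
  (sumℕ-reverse v d (λ a a<v → f≡0 (suc a) (s<s a<v)) f≡g)
sumℕ-reverse zero zero    f≡0 f≡g = cong (_+ 0) (f≡g 0 z≤n)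
sumℕ-reverse zero (suc d) f≡0 f≡g = cong₂ _+_ (f≡g 0 z≤n)
  (sumℕ-reverse zero d (λ _ ()) (λ b b≤d → f≡g (suc b) (s≤s b≤d)))

-- #asc d m, #ascUpToZero d m and #admissible k m count the words in
-- words (v + d) m, words (v + d) m and words k m that are Ascending v,
-- AscendingUpToZero v (for v > 0) and Admissible.  Only the room d between v
-- and the bound on the first letter matters: a first letter a ≥ v leaves
-- the room j + 1 for the rest of the word, where j = v + d - a.
#asc : ℕ → ℕ → ℕ
#asc d zero    = 1
#asc d (suc m) = Σ< (suc d) (λ j → #asc (suc j) m)

#ascUpToZero : ℕ → ℕ → ℕ
#ascUpToZero d zero    = 1
#ascUpToZero d (suc m) = #asc (suc d) m + Σ< (suc d) (λ j → #ascUpToZero (suc j) m)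

#admissible : ℕ → ℕ → ℕ
#admissible k zero    = 1
#admissible k (suc m) = #admissible (suc k) m + Σ< k (λ j → #ascUpToZero (suc j) m)

v+b+1+[d∸b] : ∀ v {b d} → b ≤ d → suc (v + d) ≡ (v + b) + suc (d ∸ b)
v+b+1+[d∸b] v {b} {d} b≤d = begin
  suc (v + d)             ≡⟨ cong (λ t → suc (v + t)) (m+[n∸m]≡n b≤d) ⟨
  suc (v + (b + (d ∸ b))) ≡⟨ cong suc (+-assoc v b (d ∸ b)) ⟨
  suc (v + b + (d ∸ b))   ≡⟨ +-suc (v + b) (d ∸ b) ⟨
  v + b + suc (d ∸ b)     ∎
  where open ≡-Reasoning

count-ascending : ∀ v d m → count (ascending? v) (words (v + d) m) ≡ #asc d m
count-ascending v d zero    = refl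
count-ascending v d (suc m) = trans (count-words (v + d) m (ascending? v))
  (sumℕ-reverse v d
    (λ a a<v → count-none (ascending? v ∘ (a ∷_))
      (λ (v≤a , _) → <⇒≱ a<v v≤a) (words (suc (v + d)) m))
    step)
  where
  open ≡-Reasoning
  step : ∀ b → b ≤ d →
    count (ascending? v ∘ ((v + b) ∷_)) (words (suc (v + d)) m) ≡ #asc (suc (d ∸ b)) m
  step b b≤d = begin
    count (ascending? v ∘ ((v + b) ∷_)) (words (suc (v + d)) m)
      ≡⟨ count-≐ (ascending? v ∘ ((v + b) ∷_)) (ascending? (v + b))
           (proj₂ , (m≤m+n v b ,_)) (words (suc (v + d)) m) ⟩
    count (ascending? (v + b)) (words (suc (v + d)) m)
      ≡⟨ cong (λ k → count (ascending? (v + b)) (words k m)) (v+b+1+[d∸b] v b≤d) ⟩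
    count (ascending? (v + b)) (words (v + b + suc (d ∸ b)) m)
      ≡⟨ count-ascending (v + b) (suc (d ∸ b)) m ⟩
    #asc (suc (d ∸ b)) m ∎

count-ascendingUpToZero : ∀ v d m →
  count (ascendingUpToZero? (suc v)) (words (suc v + d) m) ≡ #ascUpToZero d m
count-ascendingUpToZero v d zero    = refl
-- A leading 0 uses up the inserted zero; a leading positive letter does not.
count-ascendingUpToZero v d (suc m) =
  trans (count-words (suc v + d) m (ascendingUpToZero? (suc v)))
    (cong₂ _+_
      (trans (cong (λ k → count (ascending? (suc v)) (words k m)) (sym (+-suc (suc v) d)))
             (count-ascending (suc v) (suc d) m))
      (sumℕ-reverse v d
        (λ a a<v → count-none (ascendingUpToZero? (suc v) ∘ (suc a ∷_))
          (λ (v≤a , _) → <⇒≱ a<v (s≤s⁻¹ v≤a)) (words (suc (suc v + d)) m))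
        step))
  where
  open ≡-Reasoning
  step : ∀ b → b ≤ d →
    count (ascendingUpToZero? (suc v) ∘ (suc (v + b) ∷_)) (words (suc (suc v + d)) m)
      ≡ #ascUpToZero (suc (d ∸ b)) m
  step b b≤d = begin
    count (ascendingUpToZero? (suc v) ∘ (suc (v + b) ∷_)) (words (suc (suc v + d)) m)
      ≡⟨ count-≐ (ascendingUpToZero? (suc v) ∘ (suc (v + b) ∷_)) (ascendingUpToZero? (suc (v + b)))
           (proj₂ , (s≤s (m≤m+n v b) ,_)) (words (suc (suc v + d)) m) ⟩
    count (ascendingUpToZero? (suc (v + b))) (words (suc (suc v + d)) m)
      ≡⟨ cong (λ k → count (ascendingUpToZero? (suc (v + b))) (words k m))
           (v+b+1+[d∸b] (suc v) b≤d) ⟩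
    count (ascendingUpToZero? (suc (v + b))) (words (suc (v + b) + suc (d ∸ b)) m)
      ≡⟨ count-ascendingUpToZero (v + b) (suc (d ∸ b)) m ⟩
    #ascUpToZero (suc (d ∸ b)) m ∎

count-admissible : ∀ k m → count admissible? (words k m) ≡ #admissible k m
count-admissible k       zero    = refl
count-admissible zero    (suc m) = trans (count-words zero m admissible?)
  (cong (_+ 0) (count-admissible 1 m))
count-admissible (suc d) (suc m) = trans (count-words (suc d) m admissible?)
  (cong₂ _+_ (count-admissible (suc (suc d)) m)
    (sumℕ-reverse zero d (λ _ ()) λ b b≤d →
      trans (cong (λ k → count (ascendingUpToZero? (suc b)) (words k m))
                  (v+b+1+[d∸b] 1 b≤d))
            (count-ascendingUpToZero b (suc (d ∸ b)) m)))

∣I∣≡#admissible : ∀ n → ∣I∣ n patterns ≡ #admissible 1 n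
∣I∣≡#admissible n = begin
  count (avoidsAll? patterns) (cartesianProductWith _∷_ (upTo 1) (words 1 n))
    -- The first letter of an inversion sequence is 0.
    ≡⟨ cong (count (avoidsAll? patterns)) (++-identityʳ (List.map (0 ∷_) (words 1 n))) ⟩
  count (avoidsAll? patterns) (List.map (0 ∷_) (words 1 n))
    ≡⟨ count-map (avoidsAll? patterns) (0 ∷_) (words 1 n) ⟩
  count (avoidsAll? patterns ∘ (0 ∷_)) (words 1 n)
    ≡⟨ count-≐ (avoidsAll? patterns ∘ (0 ∷_)) admissible?
         (avoids⇒admissible _ , admissible⇒avoids _) (words 1 n) ⟩
  count admissible? (words 1 n)
    ≡⟨ count-admissible 1 n ⟩
  #admissible 1 n ∎
  where open ≡-Reasoning

-- Closed forms of the counts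

pascal : ∀ n k → suc n C suc k ≡ n C k + n C suc k
pascal n k = sym (nCk+nC[k+1]≡[n+1]C[k+1] n k)

C-middle : ∀ n → (n + suc n) C n ≡ (n + suc n) C suc n
C-middle n = trans (nCk≡nC[n∸k] (m≤m+n n (suc n))) (cong ((n + suc n) C_) (m+n∸m≡n n (suc n)))

-- The ballot numbers #asc d m = C(n, r) - C(n, r + 1), where r = m + d and
-- n = 2m + d.  The equations for r and n are hypotheses so that the
-- induction can use any form of these sums.
#asc-closed : ∀ d m {r n} → r ≡ m + d → n ≡ m + r → #asc d m + n C suc r ≡ n C r
#asc-closed d zero {r} refl refl =
  trans (cong suc (k>n⇒nCk≡0 (n<1+n r))) (sym (nCn≡1 r))
#asc-closed zero (suc m) {suc r} {suc n} r≡ n≡ = begin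
  #asc 1 m + 0 + suc n C suc (suc r)
    ≡⟨ cong (#asc 1 m + 0 +_) (pascal n (suc r)) ⟩
  #asc 1 m + 0 + (n C suc r + n C suc (suc r))
    ≡⟨ rearrange (#asc 1 m) (n C suc r) (n C suc (suc r)) ⟩
  n C suc r + (#asc 1 m + n C suc (suc r))
    ≡⟨ cong₂ _+_ symmetric ih ⟩
  n C r + n C suc r
    ≡⟨ pascal n r ⟨
  suc n C suc r ∎
  where
  open ≡-Reasoning
  rearrange : ∀ a b c → a + 0 + (b + c) ≡ b + (a + c)
  rearrange = solve-∀
  ih : #asc 1 m + n C suc (suc r) ≡ n C suc r
  ih = #asc-closed 1 m (trans r≡ (sym (+-suc m 0))) (suc-injective n≡)
  n≡r+1+r : n ≡ r + suc r
  n≡r+1+r = trans (suc-injective n≡)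
    (cong (_+ suc r) (sym (trans (suc-injective r≡) (+-identityʳ m))))
  symmetric : n C suc r ≡ n C r
  symmetric = subst (λ n → n C suc r ≡ n C r) (sym n≡r+1+r) (sym (C-middle r))
#asc-closed (suc d) (suc m) {suc r} {suc n} r≡ n≡ = begin
  #asc (suc (suc d)) m + #asc d (suc m) + suc n C suc (suc r)
    ≡⟨ cong (#asc (suc (suc d)) m + #asc d (suc m) +_) (pascal n (suc r)) ⟩
  #asc (suc (suc d)) m + #asc d (suc m) + (n C suc r + n C suc (suc r))
    ≡⟨ rearrange (#asc (suc (suc d)) m) (#asc d (suc m)) (n C suc r) (n C suc (suc r)) ⟩
  (#asc d (suc m) + n C suc r) + (#asc (suc (suc d)) m + n C suc (suc r))
    ≡⟨ cong₂ _+_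
         (#asc-closed d (suc m) (trans (suc-injective r≡) (+-suc m d))
           (trans (suc-injective n≡) (+-suc m r)))
         (#asc-closed (suc (suc d)) m (trans r≡ (sym (+-suc m (suc d)))) (suc-injective n≡)) ⟩
  n C r + n C suc r
    ≡⟨ pascal n r ⟨
  suc n C suc r ∎
  where
  open ≡-Reasoning
  rearrange : ∀ a b c d → a + b + (c + d) ≡ (b + c) + (a + d)
  rearrange = solve-∀

-- κ m d = C(2m + d, m + d + 1) and ν m d = C(2m + d, m + d + 2).
κ : ℕ → ℕ → ℕ
κ m d = (m + (m + d)) C suc (m + d)

ν : ℕ → ℕ → ℕ
ν m d = (m + (m + d)) C suc (suc (m + d))

κ-zero : ∀ d → κ 0 d ≡ 0
κ-zero d = k>n⇒nCk≡0 (n<1+n d)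

ν-zero : ∀ d → ν 0 d ≡ 0
ν-zero d = k>n⇒nCk≡0 (m<n⇒m<1+n (n<1+n d))

module _ (m d : ℕ) where

  private
    r = m + suc (suc d)
    n = m + r

    r≡ : suc m + suc d ≡ r
    r≡ = sym (+-suc m (suc d))

    n≡ : m + (suc m + suc d) ≡ n
    n≡ = cong (m +_) r≡

    r≡2+m+d : r ≡ suc (suc (m + d))
    r≡2+m+d = trans (+-suc m (suc d)) (cong suc (+-suc m d))

    κ-shift : κ (suc m) d ≡ n C r
    κ-shift = cong₂ _C_
      (trans (sym (+-suc m (suc m + d))) (cong (m +_) (sym r≡2+m+d)))
      (sym r≡2+m+d)

  κ-pascal : κ (suc m) (suc d) ≡ κ (suc m) d + κ m (suc (suc d))
  κ-pascal = begin
    suc (m + (suc m + suc d)) C suc (suc m + suc d)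
      ≡⟨ cong₂ (λ n r → suc n C suc r) n≡ r≡ ⟩
    suc n C suc r       ≡⟨ pascal n r ⟩
    n C r + n C suc r   ≡⟨ cong (_+ n C suc r) κ-shift ⟨
    κ (suc m) d + κ m (suc (suc d)) ∎
    where open ≡-Reasoning

  ν-pascal : ν (suc m) (suc d) ≡ κ m (suc (suc d)) + ν m (suc (suc d))
  ν-pascal = trans (cong₂ (λ n r → suc n C suc (suc r)) n≡ r≡) (pascal n (suc r))

  #asc+κ : #asc (suc (suc d)) m + κ m (suc (suc d)) ≡ κ (suc m) d
  #asc+κ = trans (#asc-closed (suc (suc d)) m refl refl) (sym κ-shift)

Σ<-cong : ∀ n {f g} → (∀ j → f j ≡ g j) → Σ< n f ≡ Σ< n g
Σ<-cong zero    f≡g = refl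
Σ<-cong (suc n) f≡g = cong₂ _+_ (f≡g n) (Σ<-cong n f≡g)

Σ<-+ : ∀ n f g → Σ< n (λ j → f j + g j) ≡ Σ< n f + Σ< n g
Σ<-+ zero    f g = refl
Σ<-+ (suc n) f g = trans (cong (f n + g n +_) (Σ<-+ n f g))
  (rearrange (f n) (g n) (Σ< n f) (Σ< n g))
  where
  rearrange : ∀ a b c d → a + b + (c + d) ≡ (a + c) + (b + d)
  rearrange = solve-∀

-- The number of words counted by #ascUpToZero d m that contain a letter 0.
#zeroInserted : ℕ → ℕ → ℕ
#zeroInserted d zero    = 0
#zeroInserted d (suc m) = suc d * κ m (suc d) + #asc (suc d) m

Σ<-#zeroInserted : ∀ k m → Σ< k (λ j → #zeroInserted (suc j) m) ≡ k * κ m k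
Σ<-#zeroInserted zero    m       = refl
Σ<-#zeroInserted (suc k) zero    = begin
  Σ< k (λ j → #zeroInserted (suc j) 0) ≡⟨ Σ<-#zeroInserted k 0 ⟩
  k * κ 0 k                            ≡⟨ cong (k *_) (κ-zero k) ⟩
  k * 0                                ≡⟨ *-zeroʳ k ⟩
  0                                    ≡⟨ *-zeroʳ (suc k) ⟨
  suc k * 0                            ≡⟨ cong (suc k *_) (κ-zero (suc k)) ⟨
  suc k * κ 0 (suc k)                  ∎
  where open ≡-Reasoning
Σ<-#zeroInserted (suc k) (suc m) = begin
  suc (suc k) * y + a + Σ< k (λ j → #zeroInserted (suc j) (suc m))
    ≡⟨ cong (suc (suc k) * y + a +_) (Σ<-#zeroInserted k (suc m)) ⟩
  suc (suc k) * y + a + k * x ≡⟨ rearrange k a x y ⟩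
  suc k * y + (a + y) + k * x ≡⟨ cong (λ t → suc k * y + t + k * x) (#asc+κ m k) ⟩
  suc k * y + x + k * x       ≡⟨ collect k x y ⟩
  suc k * (x + y)             ≡⟨ cong (suc k *_) (κ-pascal m k) ⟨
  suc k * κ (suc m) (suc k)   ∎
  where
  open ≡-Reasoning
  a = #asc (suc (suc k)) m
  x = κ (suc m) k
  y = κ m (suc (suc k))
  rearrange : ∀ k a x y → suc (suc k) * y + a + k * x ≡ suc k * y + (a + y) + k * x
  rearrange = solve-∀
  collect : ∀ k x y → suc k * y + x + k * x ≡ suc k * (x + y)
  collect = solve-∀

-- Proved by mutual recursion with the lemma after it.
#ascUpToZero-closed : ∀ d m → #ascUpToZero d m ≡ #asc d m + #zeroInserted d m

Σ<-#ascUpToZero : ∀ k m →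
  Σ< k (λ j → #ascUpToZero (suc j) m) ≡ Σ< k (λ j → #asc (suc j) m) + k * κ m k
Σ<-#ascUpToZero k m = begin
  Σ< k (λ j → #ascUpToZero (suc j) m)
    ≡⟨ Σ<-cong k (λ j → #ascUpToZero-closed (suc j) m) ⟩
  Σ< k (λ j → #asc (suc j) m + #zeroInserted (suc j) m)
    ≡⟨ Σ<-+ k (λ j → #asc (suc j) m) (λ j → #zeroInserted (suc j) m) ⟩
  Σ< k (λ j → #asc (suc j) m) + Σ< k (λ j → #zeroInserted (suc j) m)
    ≡⟨ cong (Σ< k (λ j → #asc (suc j) m) +_) (Σ<-#zeroInserted k m) ⟩
  Σ< k (λ j → #asc (suc j) m) + k * κ m k ∎
  where open ≡-Reasoning

#ascUpToZero-closed d zero    = refl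
#ascUpToZero-closed d (suc m) = begin
  #asc (suc d) m + Σ< (suc d) (λ j → #ascUpToZero (suc j) m)
    ≡⟨ cong (#asc (suc d) m +_) (Σ<-#ascUpToZero (suc d) m) ⟩
  #asc (suc d) m + (#asc d (suc m) + suc d * κ m (suc d))
    ≡⟨ rearrange (#asc (suc d) m) (#asc d (suc m)) (suc d * κ m (suc d)) ⟩
  #asc d (suc m) + (suc d * κ m (suc d) + #asc (suc d) m) ∎
  where
  open ≡-Reasoning
  rearrange : ∀ a b c → a + (b + c) ≡ b + (c + a)
  rearrange = solve-∀

-- The number of admissible words in words k m with a letter 0 after a
-- positive one.
#lateZero : ℕ → ℕ → ℕ
#lateZero k zero    = 0
#lateZero k (suc m) = k * κ m (suc k) + ν m (suc k)

#lateZero-step : ∀ k m → #lateZero (suc k) m + k * κ m k ≡ #lateZero k (suc m)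
#lateZero-step k zero    =
  trans (cong (k *_) (trans (κ-zero k) (sym (κ-zero (suc k)))))
        (trans (sym (+-identityʳ _)) (cong (k * κ 0 (suc k) +_) (sym (ν-zero (suc k)))))
#lateZero-step k (suc m) = begin
  suc k * y + z + k * x                        ≡⟨ rearrange k x y z ⟩
  k * (x + y) + (y + z)
    ≡⟨ cong₂ (λ s t → k * s + t) (κ-pascal m k) (ν-pascal m k) ⟨
  k * κ (suc m) (suc k) + ν (suc m) (suc k)    ∎
  where
  open ≡-Reasoning
  x = κ (suc m) k
  y = κ m (suc (suc k))
  z = ν m (suc (suc k))
  rearrange : ∀ k x y z → suc k * y + z + k * x ≡ k * (x + y) + (y + z)
  rearrange = solve-∀

#admissible-closed : ∀ k m → #admissible k m ≡ #asc k m + #lateZero k m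
#admissible-closed k zero    = refl
#admissible-closed k (suc m) = begin
  #admissible (suc k) m + Σ< k (λ j → #ascUpToZero (suc j) m)
    ≡⟨ cong₂ _+_ (#admissible-closed (suc k) m) (Σ<-#ascUpToZero k m) ⟩
  (#asc (suc k) m + #lateZero (suc k) m) + (Σ< k (λ j → #asc (suc j) m) + k * κ m k)
    ≡⟨ rearrange (#asc (suc k) m) (#lateZero (suc k) m)
                 (Σ< k (λ j → #asc (suc j) m)) (k * κ m k) ⟩
  #asc k (suc m) + (#lateZero (suc k) m + k * κ m k)
    ≡⟨ cong (#asc k (suc m) +_) (#lateZero-step k m) ⟩
  #asc k (suc m) + #lateZero k (suc m) ∎
  where
  open ≡-Reasoning
  rearrange : ∀ a b c d → (a + b) + (c + d) ≡ (a + c) + (b + d)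
  rearrange = solve-∀

-- |I_n(100,021)| = C(N, n+1) - C(N, n+2) + C(N, n+3), where N = 2n + 1.
∣I∣-binomial : ∀ n → let N = n + suc n in
  ∣I∣ n patterns + N C (2 + n) ≡ N C (1 + n) + N C (3 + n)
∣I∣-binomial n = +-cancelʳ-≡ (N C suc n) _ _ (begin
  ∣I∣ n patterns + p₁ + p₀ ≡⟨ cong (λ t → t + p₁ + p₀) count-I ⟩
  (c + p₂) + p₁ + p₀       ≡⟨ rearrange c p₀ p₁ p₂ ⟩
  (c + (p₀ + p₁)) + p₂     ≡⟨ cong (_+ p₂) catalan ⟩
  (p₀ + p₀) + p₂           ≡⟨ rearrange′ p₀ p₂ ⟩
  (p₀ + p₂) + p₀           ∎)
  where
  open ≡-Reasoning
  N  = n + suc n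
  p₀ = N C (1 + n)
  p₁ = N C (2 + n)
  p₂ = N C (3 + n)
  c  = #asc 0 (suc n)
  rearrange : ∀ c p₀ p₁ p₂ → c + p₂ + p₁ + p₀ ≡ (c + (p₀ + p₁)) + p₂
  rearrange = solve-∀
  rearrange′ : ∀ p₀ p₂ → (p₀ + p₀) + p₂ ≡ (p₀ + p₂) + p₀
  rearrange′ = solve-∀
  ν≡p₂ : ν n 1 ≡ p₂
  ν≡p₂ = cong (λ r → (n + r) C suc (suc r)) (+-comm n 1)
  count-I : ∣I∣ n patterns ≡ c + p₂
  count-I = begin
    ∣I∣ n patterns      ≡⟨ ∣I∣≡#admissible n ⟩
    -- The formula is simplest for words 0 (suc n), where the first letter is 0.
    #admissible 1 n     ≡⟨ +-identityʳ _ ⟨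
    #admissible 1 n + 0 ≡⟨ #admissible-closed 0 (suc n) ⟩
    c + ν n 1           ≡⟨ cong (c +_) ν≡p₂ ⟩
    c + p₂              ∎
  -- c is the Catalan number, counting the weakly increasing inversion sequences.
  catalan : c + (p₀ + p₁) ≡ p₀ + p₀
  catalan = begin
    c + (p₀ + p₁)                 ≡⟨ cong (c +_) (pascal N (suc n)) ⟨
    c + suc N C suc (suc n)       ≡⟨ #asc-closed 0 (suc n) (sym (+-identityʳ (suc n))) refl ⟩
    suc N C suc n                 ≡⟨ pascal N n ⟩
    N C n + p₀                    ≡⟨ cong (_+ p₀) (C-middle n) ⟩
    p₀ + p₀                       ∎

-- Central binomial coefficients

-- Division-free form of C(n, k+1) / C(n, k) = (n - k) / (k + 1).
C-ratio : ∀ n k → suc k * (n C suc k) + k * (n C k) ≡ n * (n C k)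
C-ratio zero    zero    = refl
C-ratio zero    (suc k) = cong₂ _+_ (*-zeroʳ (suc (suc k))) (*-zeroʳ (suc k))
C-ratio (suc n) zero    = trans (cong (λ t → 1 * t + 0) (pascal n 0))
  (trans (rearrange (n C 1)) (cong suc (C-ratio n 0)))
  where
  rearrange : ∀ a → 1 * (1 + a) + 0 ≡ suc (1 * a + 0)
  rearrange = solve-∀
C-ratio (suc n) (suc k) = begin
  suc (suc k) * (suc n C suc (suc k)) + suc k * (suc n C suc k)
    ≡⟨ cong₂ (λ s t → suc (suc k) * s + suc k * t) (pascal n (suc k)) (pascal n k) ⟩
  suc (suc k) * (b + c) + suc k * (a + b)
    ≡⟨ rearrange k a b c ⟩
  (suc (suc k) * c + suc k * b) + (suc k * b + k * a) + (a + b)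
    ≡⟨ cong₂ (λ s t → s + t + (a + b)) (C-ratio n (suc k)) (C-ratio n k) ⟩
  n * b + n * a + (a + b)
    ≡⟨ collect n a b ⟩
  suc n * (a + b)
    ≡⟨ cong (suc n *_) (pascal n k) ⟨
  suc n * (suc n C suc k) ∎
  where
  open ≡-Reasoning
  a = n C k
  b = n C suc k
  c = n C suc (suc k)
  rearrange : ∀ k a b c → suc (suc k) * (b + c) + suc k * (a + b) ≡
                          (suc (suc k) * c + suc k * b) + (suc k * b + k * a) + (a + b)
  rearrange = solve-∀
  collect : ∀ n a b → n * b + n * a + (a + b) ≡ suc n * (a + b)
  collect = solve-∀

C-absorb : ∀ n k → suc k * (suc n C suc k) ≡ suc n * (n C k)
C-absorb n k = begin
  suc k * (suc n C suc k)     ≡⟨ cong (suc k *_) (pascal n k) ⟩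
  suc k * (a + b)             ≡⟨ rearrange k a b ⟩
  a + (suc k * b + k * a)     ≡⟨ cong (a +_) (C-ratio n k) ⟩
  suc n * a                   ∎
  where
  open ≡-Reasoning
  a = n C k
  b = n C suc k
  rearrange : ∀ k a b → suc k * (a + b) ≡ a + (suc k * b + k * a)
  rearrange = solve-∀

-- The central binomial coefficient C(2n, n).
central : ℕ → ℕ
central n = (n + n) C n

-- mid j n = C(2n + 1, n + 1 + j), at distance j from the middle of its row.
mid : ℕ → ℕ → ℕ
mid j n = (n + suc n) C suc (j + n)

central-suc : ∀ n → central (suc n) ≡ 2 * mid 0 n
central-suc n = begin
  suc (n + suc n) C suc n          ≡⟨ pascal (n + suc n) n ⟩
  (n + suc n) C n + mid 0 n        ≡⟨ cong (_+ mid 0 n) (C-middle n) ⟩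
  mid 0 n + mid 0 n                ≡⟨ cong (mid 0 n +_) (+-identityʳ (mid 0 n)) ⟨
  2 * mid 0 n                      ∎
  where open ≡-Reasoning

central-recurrence : ∀ n → suc n * central (suc n) ≡ (4 * n + 2) * central n
central-recurrence n = begin
  suc n * central (suc n)               ≡⟨ cong (suc n *_) (central-suc n) ⟩
  suc n * (2 * ((n + suc n) C suc n))   ≡⟨ cong (λ N → suc n * (2 * (N C suc n))) (+-suc n n) ⟩
  suc n * (2 * (suc (n + n) C suc n))   ≡⟨ rearrange n (suc (n + n) C suc n) ⟩
  2 * (suc n * (suc (n + n) C suc n))   ≡⟨ cong (2 *_) (C-absorb (n + n) n) ⟩
  2 * (suc (n + n) * central n)         ≡⟨ collect n (central n) ⟩
  (4 * n + 2) * central n               ∎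
  where
  open ≡-Reasoning
  rearrange : ∀ n a → suc n * (2 * a) ≡ 2 * (suc n * a)
  rearrange = solve-∀
  collect : ∀ n a → 2 * (suc (n + n) * a) ≡ (4 * n + 2) * a
  collect = solve-∀

mid-suc : ∀ j n → mid (suc j) (suc n) ≡ mid j n + 2 * mid (suc j) n + mid (2 + j) n
mid-suc j n = begin
  (suc n + suc (suc n)) C suc (suc (j + suc n))
    ≡⟨ cong₂ (λ N k → suc N C suc (suc k)) (+-suc n (suc n)) (+-suc j n) ⟩
  suc (suc N) C suc (suc (suc (j + n)))
    ≡⟨ pascal (suc N) (suc (suc (j + n))) ⟩
  suc N C suc (suc (j + n)) + suc N C suc (suc (suc (j + n)))
    ≡⟨ cong₂ _+_ (pascal N (suc (j + n))) (pascal N (suc (suc (j + n)))) ⟩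
  (mid j n + mid (suc j) n) + (mid (suc j) n + mid (2 + j) n)
    ≡⟨ rearrange (mid j n) (mid (suc j) n) (mid (2 + j) n) ⟩
  mid j n + 2 * mid (suc j) n + mid (2 + j) n ∎
  where
  open ≡-Reasoning
  N = n + suc n
  rearrange : ∀ a b c → (a + b) + (b + c) ≡ a + 2 * b + c
  rearrange = solve-∀

mid-zero-suc : ∀ n → mid 0 (suc n) ≡ 3 * mid 0 n + mid 1 n
mid-zero-suc n = begin
  (suc n + suc (suc n)) C suc (suc n)
    ≡⟨ cong (λ N → suc N C suc (suc n)) (+-suc n (suc n)) ⟩
  suc (suc N) C suc (suc n)
    ≡⟨ pascal (suc N) (suc n) ⟩
  suc N C suc n + suc N C suc (suc n)
    ≡⟨ cong₂ _+_ (central-suc n) (pascal N (suc n)) ⟩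
  2 * mid 0 n + (mid 0 n + mid 1 n)
    ≡⟨ rearrange (mid 0 n) (mid 1 n) ⟩
  3 * mid 0 n + mid 1 n ∎
  where
  open ≡-Reasoning
  N = n + suc n
  rearrange : ∀ a b → 2 * a + (a + b) ≡ 3 * a + b
  rearrange = solve-∀

-- The coefficient of x^(n+3) in (1 - 6x + 9x²) / √(1 - 4x) is twice
-- |I_n(100,021)|.
∣I∣-central : ∀ n →
  2 * ∣I∣ n patterns + 6 * central (2 + n) ≡ central (3 + n) + 9 * central (1 + n)
∣I∣-central n = begin
  2 * i + 6 * central (2 + n)
    ≡⟨ cong (λ t → 2 * i + 6 * t) central₂ ⟩
  2 * i + 6 * (2 * (3 * p₀ + p₁))
    ≡⟨ rearrange i p₀ p₁ ⟩
  2 * (i + p₁) + 10 * p₁ + 36 * p₀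
    ≡⟨ cong (λ t → 2 * t + 10 * p₁ + 36 * p₀) (∣I∣-binomial n) ⟩
  2 * (p₀ + p₂) + 10 * p₁ + 36 * p₀
    ≡⟨ collect p₀ p₁ p₂ ⟩
  2 * (3 * (3 * p₀ + p₁) + (p₀ + 2 * p₁ + p₂)) + 9 * (2 * p₀)
    ≡⟨ cong₂ (λ s t → s + 9 * t) central₃ (central-suc n) ⟨
  central (3 + n) + 9 * central (1 + n) ∎
  where
  open ≡-Reasoning
  i  = ∣I∣ n patterns
  p₀ = mid 0 n
  p₁ = mid 1 n
  p₂ = mid 2 n
  central₂ : central (2 + n) ≡ 2 * (3 * p₀ + p₁)
  central₂ = trans (central-suc (suc n)) (cong (2 *_) (mid-zero-suc n))
  central₃ : central (3 + n) ≡ 2 * (3 * (3 * p₀ + p₁) + (p₀ + 2 * p₁ + p₂))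
  central₃ = trans (central-suc (2 + n)) (cong (2 *_) (trans (mid-zero-suc (suc n))
    (cong₂ (λ s t → 3 * s + t) (mid-zero-suc n) (mid-suc 0 n))))
  rearrange : ∀ i a b → 2 * i + 6 * (2 * (3 * a + b)) ≡ 2 * (i + b) + 10 * b + 36 * a
  rearrange = solve-∀
  collect : ∀ a b c → 2 * (a + c) + 10 * b + 36 * a ≡
                      2 * (3 * (3 * a + b) + (a + 2 * b + c)) + 9 * (2 * a)
  collect = solve-∀

mid-one : ∀ n → (2 + n) * mid 1 n ≡ n * mid 0 n
mid-one n = +-cancelʳ-≡ (suc n * mid 0 n) _ _ (begin
  (2 + n) * mid 1 n + suc n * mid 0 n ≡⟨ C-ratio (n + suc n) (suc n) ⟩
  (n + suc n) * mid 0 n               ≡⟨ *-distribʳ-+ (mid 0 n) n (suc n) ⟩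
  n * mid 0 n + suc n * mid 0 n       ∎)
  where open ≡-Reasoning

mid-two : ∀ n →
  (2 + n) * ((3 + n) * mid 2 n) + n * ((2 + n) * mid 0 n) ≡ (n + suc n) * (n * mid 0 n)
mid-two n = begin
  (2 + n) * ((3 + n) * p₂) + n * ((2 + n) * p₀)
    ≡⟨ rearrange n (2 + n) p₀ ((2 + n) * ((3 + n) * p₂)) ⟩
  (2 + n) * ((3 + n) * p₂) + (2 + n) * (n * p₀)
    ≡⟨ cong (λ t → (2 + n) * ((3 + n) * p₂) + (2 + n) * t) (mid-one n) ⟨
  (2 + n) * ((3 + n) * p₂) + (2 + n) * ((2 + n) * p₁)
    ≡⟨ *-distribˡ-+ (2 + n) ((3 + n) * p₂) ((2 + n) * p₁) ⟨
  (2 + n) * ((3 + n) * p₂ + (2 + n) * p₁)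
    ≡⟨ cong ((2 + n) *_) (C-ratio (n + suc n) (2 + n)) ⟩
  (2 + n) * ((n + suc n) * p₁)
    ≡⟨ swap (2 + n) (n + suc n) p₁ ⟩
  (n + suc n) * ((2 + n) * p₁)
    ≡⟨ cong ((n + suc n) *_) (mid-one n) ⟩
  (n + suc n) * (n * p₀) ∎
  where
  open ≡-Reasoning
  p₀ = mid 0 n
  p₁ = mid 1 n
  p₂ = mid 2 n
  rearrange : ∀ n m a b → b + n * (m * a) ≡ b + m * (n * a)
  rearrange = solve-∀
  swap : ∀ a b c → a * (b * c) ≡ b * (a * c)
  swap = solve-∀

∣I∣-closed : ∀ n →
  ∣I∣ n patterns * (2 * (3 + n) * (2 + n)) ≡ (n * n + n + 6) * ((2 * n + 2) C (n + 1))
∣I∣-closed n = trans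
  -- The added terms complete the left sides of ∣I∣-binomial and mid-two.
  (+-cancelʳ-≡ (2 * (3 + n) * ((2 + n) * p₁) + 2 * (n * ((2 + n) * p₀))) _ _ (begin
    i * (2 * (3 + n) * (2 + n)) + (2 * (3 + n) * ((2 + n) * p₁) + 2 * (n * ((2 + n) * p₀)))
      ≡⟨ split i n p₀ p₁ ⟩
    2 * (3 + n) * (2 + n) * (i + p₁) + 2 * (n * ((2 + n) * p₀))
      ≡⟨ cong (λ t → 2 * (3 + n) * (2 + n) * t + 2 * (n * ((2 + n) * p₀))) (∣I∣-binomial n) ⟩
    2 * (3 + n) * (2 + n) * (p₀ + p₂) + 2 * (n * ((2 + n) * p₀))
      ≡⟨ regroup n p₀ p₂ ⟩
    2 * (3 + n) * (2 + n) * p₀ + 2 * ((2 + n) * ((3 + n) * p₂) + n * ((2 + n) * p₀))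
      ≡⟨ cong (λ t → 2 * (3 + n) * (2 + n) * p₀ + 2 * t) (mid-two n) ⟩
    2 * (3 + n) * (2 + n) * p₀ + 2 * ((n + suc n) * (n * p₀))
      ≡⟨ polynomial n p₀ ⟩
    (n * n + n + 6) * (2 * p₀) + (2 * (3 + n) * (n * p₀) + 2 * (n * ((2 + n) * p₀)))
      ≡⟨ cong (λ t → (n * n + n + 6) * (2 * p₀) + (2 * (3 + n) * t + 2 * (n * ((2 + n) * p₀))))
              (mid-one n) ⟨
    (n * n + n + 6) * (2 * p₀) + (2 * (3 + n) * ((2 + n) * p₁) + 2 * (n * ((2 + n) * p₀))) ∎))
  (cong ((n * n + n + 6) *_) (sym (trans
    (cong₂ _C_ (double n) (+-comm n 1)) (central-suc n))))
  where
  open ≡-Reasoning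
  i  = ∣I∣ n patterns
  p₀ = mid 0 n
  p₁ = mid 1 n
  p₂ = mid 2 n
  double : ∀ n → 2 * n + 2 ≡ suc n + suc n
  double = solve-∀
  split : ∀ i n a b →
    i * (2 * (3 + n) * (2 + n)) + (2 * (3 + n) * ((2 + n) * b) + 2 * (n * ((2 + n) * a)))
      ≡ 2 * (3 + n) * (2 + n) * (i + b) + 2 * (n * ((2 + n) * a))
  split = solve-∀
  regroup : ∀ n a c →
    2 * (3 + n) * (2 + n) * (a + c) + 2 * (n * ((2 + n) * a))
      ≡ 2 * (3 + n) * (2 + n) * a + 2 * ((2 + n) * ((3 + n) * c) + n * ((2 + n) * a))
  regroup = solve-∀
  polynomial : ∀ n a →
    2 * (3 + n) * (2 + n) * a + 2 * ((n + suc n) * (n * a))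
      ≡ (n * n + n + 6) * (2 * a) + (2 * (3 + n) * (n * a) + 2 * (n * ((2 + n) * a)))
  polynomial = solve-∀

-- Natural numbers as rational numbers

open import Data.Integer.Base using (ℤ; +_; -[1+_])

fromℕᵘ : ℕ → ℚᵘ.ℚᵘ
fromℕᵘ n = ℚᵘ.mkℚᵘ (+ n) 0

fromℕ-+ : ∀ m n → fromℕ (m + n) ≡ fromℕ m ℚ.+ fromℕ n
fromℕ-+ m n = ℚ.toℚᵘ-injective (begin
  ℚ.toℚᵘ (fromℕ (m + n))                      ≈⟨ ℚ.toℚᵘ-fromℚᵘ (fromℕᵘ (m + n)) ⟩
  fromℕᵘ (m + n)                              ≈⟨ ℚᵘ.*≡* (cong (ℤ._* + 1)
      (cong₂ ℤ._+_ (ℤ.*-identityʳ (+ m)) (ℤ.*-identityʳ (+ n)))) ⟨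
  fromℕᵘ m ℚᵘ.+ fromℕᵘ n                      ≈⟨ ℚᵘ.+-cong
      (ℚ.toℚᵘ-fromℚᵘ (fromℕᵘ m)) (ℚ.toℚᵘ-fromℚᵘ (fromℕᵘ n)) ⟨
  ℚ.toℚᵘ (fromℕ m) ℚᵘ.+ ℚ.toℚᵘ (fromℕ n)      ≈⟨ ℚ.toℚᵘ-homo-+ (fromℕ m) (fromℕ n) ⟨
  ℚ.toℚᵘ (fromℕ m ℚ.+ fromℕ n)                ∎)
  where open ≃-Reasoning

fromℕ-* : ∀ m n → fromℕ (m * n) ≡ fromℕ m ℚ.* fromℕ n
fromℕ-* m n = ℚ.toℚᵘ-injective (begin
  ℚ.toℚᵘ (fromℕ (m * n))                      ≈⟨ ℚ.toℚᵘ-fromℚᵘ (fromℕᵘ (m * n)) ⟩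
  fromℕᵘ (m * n)                              ≈⟨ ℚᵘ.*≡* (cong (ℤ._* + 1) (ℤ.pos-* m n)) ⟩
  fromℕᵘ m ℚᵘ.* fromℕᵘ n                      ≈⟨ ℚᵘ.*-cong
      (ℚ.toℚᵘ-fromℚᵘ (fromℕᵘ m)) (ℚ.toℚᵘ-fromℚᵘ (fromℕᵘ n)) ⟨
  ℚ.toℚᵘ (fromℕ m) ℚᵘ.* ℚ.toℚᵘ (fromℕ n)      ≈⟨ ℚ.toℚᵘ-homo-* (fromℕ m) (fromℕ n) ⟨
  ℚ.toℚᵘ (fromℕ m ℚ.* fromℕ n)                ∎)
  where open ≃-Reasoning

/-*-cancel : ∀ m n .{{_ : NonZero n}} → (+ m ℚ./ n) ℚ.* fromℕ n ≡ fromℕ m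
/-*-cancel m (suc n) = ℚ.toℚᵘ-injective (begin
  ℚ.toℚᵘ ((+ m ℚ./ suc n) ℚ.* fromℕ (suc n))  ≈⟨ ℚ.toℚᵘ-homo-* (+ m ℚ./ suc n) (fromℕ (suc n)) ⟩
  ℚ.toℚᵘ (+ m ℚ./ suc n) ℚᵘ.* ℚ.toℚᵘ (fromℕ (suc n))
    ≈⟨ ℚᵘ.*-cong (ℚ.toℚᵘ-fromℚᵘ (ℚᵘ.mkℚᵘ (+ m) n)) (ℚ.toℚᵘ-fromℚᵘ (fromℕᵘ (suc n))) ⟩
  ℚᵘ.mkℚᵘ (+ m) n ℚᵘ.* fromℕᵘ (suc n)
    ≈⟨ ℚᵘ.*≡* (trans (ℤ.*-identityʳ _) (cong (+ m ℤ.*_) (cong +_ (sym (*-identityʳ (suc n)))))) ⟩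
  fromℕᵘ m                                    ≈⟨ ℚ.toℚᵘ-fromℚᵘ (fromℕᵘ m) ⟨
  ℚ.toℚᵘ (fromℕ m)                            ∎)
  where open ≃-Reasoning

ℚ-*-cancelˡ : ∀ c .{{_ : ℚ.NonZero c}} {p q} → c ℚ.* p ≡ c ℚ.* q → p ≡ q
ℚ-*-cancelˡ c {p} {q} cp≡cq = begin
  p                     ≡⟨ restore p ⟨
  ℚ.1/ c ℚ.* (c ℚ.* p)  ≡⟨ cong (ℚ.1/ c ℚ.*_) cp≡cq ⟩
  ℚ.1/ c ℚ.* (c ℚ.* q)  ≡⟨ restore q ⟩
  q                     ∎
  where
  open ≡-Reasoning
  restore : ∀ p → ℚ.1/ c ℚ.* (c ℚ.* p) ≡ p
  restore p = trans (sym (ℚ.*-assoc (ℚ.1/ c) c p))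
    (trans (cong (ℚ._* p) (ℚ.*-inverseˡ c)) (ℚ.*-identityˡ p))

fromℕ-nonZero : ∀ n .{{_ : NonZero n}} → ℚ.NonZero (fromℕ n)
fromℕ-nonZero n = ℚ.pos⇒nonZero (fromℕ n) {{ℚ.normalize-pos n 1}}

fromℕ-quotient : ∀ {a m n b} .{{_ : NonZero n}} → a * n ≡ m * b →
                 fromℕ a ≡ (+ m ℚ./ n) ℚ.* fromℕ b
fromℕ-quotient {a} {m} {n} {b} an≡mb = ℚ-*-cancelˡ (fromℕ n) {{fromℕ-nonZero n}} (begin
  fromℕ n ℚ.* fromℕ a                     ≡⟨ ℚ.*-comm (fromℕ n) (fromℕ a) ⟩
  fromℕ a ℚ.* fromℕ n                     ≡⟨ fromℕ-* a n ⟨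
  fromℕ (a * n)                           ≡⟨ cong fromℕ an≡mb ⟩
  fromℕ (m * b)                           ≡⟨ fromℕ-* m b ⟩
  fromℕ m ℚ.* fromℕ b                     ≡⟨ cong (ℚ._* fromℕ b) (/-*-cancel m n) ⟨
  (+ m ℚ./ n) ℚ.* fromℕ n ℚ.* fromℕ b     ≡⟨ solve 3 (λ q n b → q :* n :* b := n :* (q :* b))
                                               refl (+ m ℚ./ n) (fromℕ n) (fromℕ b) ⟩
  fromℕ n ℚ.* ((+ m ℚ./ n) ℚ.* fromℕ b)   ∎)
  where open ≡-Reasoning

-- The ring of power series

infixl 6 _⊕_
_⊕_ : PowerSeries → PowerSeries → PowerSeries
(f ⊕ g) n = f n ℚ.+ g n

infixl 7 _•_
_•_ : ℚ → PowerSeries → PowerSeries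
(c • f) n = c ℚ.* f n

⊛-congˡ : ∀ f {g g′} → g ≗ g′ → f ⊛ g ≗ f ⊛ g′
⊛-congˡ f g≗g′ n = sum-cong-≗ {suc n} λ i → cong (f (toℕ i) ℚ.*_) (g≗g′ (n ∸ toℕ i))

⊛-congʳ : ∀ g {f f′} → f ≗ f′ → f ⊛ g ≗ f′ ⊛ g
⊛-congʳ g f≗f′ n = sum-cong-≗ {suc n} λ i → cong (ℚ._* g (n ∸ toℕ i)) (f≗f′ (toℕ i))

⊛-distribʳ-⊕ : ∀ f g h → (f ⊕ g) ⊛ h ≗ (f ⊛ h) ⊕ (g ⊛ h)
⊛-distribʳ-⊕ f g h n = trans
  (sum-cong-≗ {suc n} λ i → ℚ.*-distribʳ-+ (h (n ∸ toℕ i)) (f (toℕ i)) (g (toℕ i)))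
  (∑-distrib-+ {suc n} (λ i → f (toℕ i) ℚ.* h (n ∸ toℕ i)) (λ i → g (toℕ i) ℚ.* h (n ∸ toℕ i)))

⊛-distribˡ-⊕ : ∀ f g h → f ⊛ (g ⊕ h) ≗ (f ⊛ g) ⊕ (f ⊛ h)
⊛-distribˡ-⊕ f g h n = trans
  (sum-cong-≗ {suc n} λ i → ℚ.*-distribˡ-+ (f (toℕ i)) (g (n ∸ toℕ i)) (h (n ∸ toℕ i)))
  (∑-distrib-+ {suc n} (λ i → f (toℕ i) ℚ.* g (n ∸ toℕ i)) (λ i → f (toℕ i) ℚ.* h (n ∸ toℕ i)))

⊛-•ˡ : ∀ c f g → (c • f) ⊛ g ≗ c • (f ⊛ g)
⊛-•ˡ c f g n = trans
  (sum-cong-≗ {suc n} λ i → ℚ.*-assoc c (f (toℕ i)) (g (n ∸ toℕ i)))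
  (sym (*-distribˡ-sum {suc n} c (λ i → f (toℕ i) ℚ.* g (n ∸ toℕ i))))

-- By definition (f ⊛ g) (suc n) is f 0 * g (suc n) + ((f ∘ suc) ⊛ g) n;
-- this is the mirror image of that recursion.
⊛-sucʳ : ∀ f g n → (f ⊛ g) (suc n) ≡ (f ⊛ (g ∘ suc)) n ℚ.+ f (suc n) ℚ.* g 0
⊛-sucʳ f g zero    = solve 3 (λ a b c → a :+ (b :+ c) := a :+ c :+ b) refl
  (f 0 ℚ.* g 1) (f 1 ℚ.* g 0) 0ℚ
⊛-sucʳ f g (suc n) = trans
  (cong (f 0 ℚ.* g (suc (suc n)) ℚ.+_) (⊛-sucʳ (f ∘ suc) g n))
  (sym (ℚ.+-assoc (f 0 ℚ.* g (suc (suc n))) (((f ∘ suc) ⊛ (g ∘ suc)) n)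
                  (f (suc (suc n)) ℚ.* g 0)))

⊛-comm : ∀ f g → f ⊛ g ≗ g ⊛ f
⊛-comm f g zero    = cong (ℚ._+ 0ℚ) (ℚ.*-comm (f 0) (g 0))
⊛-comm f g (suc n) = begin
  f 0 ℚ.* g (suc n) ℚ.+ ((f ∘ suc) ⊛ g) n
    ≡⟨ cong₂ ℚ._+_ (ℚ.*-comm (f 0) (g (suc n))) (⊛-comm (f ∘ suc) g n) ⟩
  g (suc n) ℚ.* f 0 ℚ.+ (g ⊛ (f ∘ suc)) n
    ≡⟨ ℚ.+-comm (g (suc n) ℚ.* f 0) ((g ⊛ (f ∘ suc)) n) ⟩
  (g ⊛ (f ∘ suc)) n ℚ.+ g (suc n) ℚ.* f 0 ≡⟨ ⊛-sucʳ g f n ⟨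
  (g ⊛ f) (suc n)                         ∎
  where open ≡-Reasoning

⊛-assoc : ∀ f g h → (f ⊛ g) ⊛ h ≗ f ⊛ (g ⊛ h)
⊛-assoc f g h zero    = solve 3
  (λ a b c → (a :* b :+ con 0ℚ) :* c :+ con 0ℚ := a :* (b :* c :+ con 0ℚ) :+ con 0ℚ) refl
  (f 0) (g 0) (h 0)
⊛-assoc f g h (suc n) = begin
  (f ⊛ g) 0 ℚ.* h (suc n) ℚ.+ (((f ⊛ g) ∘ suc) ⊛ h) n
    ≡⟨ cong ((f ⊛ g) 0 ℚ.* h (suc n) ℚ.+_) tail ⟩
  (f 0 ℚ.* g 0 ℚ.+ 0ℚ) ℚ.* h (suc n) ℚ.+ (f 0 ℚ.* ((g ∘ suc) ⊛ h) n ℚ.+ ((f ∘ suc) ⊛ (g ⊛ h)) n)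
    ≡⟨ solve 5 (λ a b c s t →
         (a :* b :+ con 0ℚ) :* c :+ (a :* s :+ t) := a :* (b :* c :+ s) :+ t) refl
         (f 0) (g 0) (h (suc n)) (((g ∘ suc) ⊛ h) n) (((f ∘ suc) ⊛ (g ⊛ h)) n) ⟩
  (f ⊛ (g ⊛ h)) (suc n) ∎
  where
  open ≡-Reasoning
  tail : (((f ⊛ g) ∘ suc) ⊛ h) n ≡ f 0 ℚ.* ((g ∘ suc) ⊛ h) n ℚ.+ ((f ∘ suc) ⊛ (g ⊛ h)) n
  tail = trans (⊛-distribʳ-⊕ (f 0 • (g ∘ suc)) ((f ∘ suc) ⊛ g) h n)
    (cong₂ ℚ._+_ (⊛-•ˡ (f 0) (g ∘ suc) h n) (⊛-assoc (f ∘ suc) g h n))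

0ˢ : PowerSeries
0ˢ _ = 0ℚ

⊛-zeroˡ : ∀ f → 0ˢ ⊛ f ≗ 0ˢ
⊛-zeroˡ f zero    = trans (ℚ.+-identityʳ (0ℚ ℚ.* f 0)) (ℚ.*-zeroˡ (f 0))
⊛-zeroˡ f (suc n) = trans (cong₂ ℚ._+_ (ℚ.*-zeroˡ (f (suc n))) (⊛-zeroˡ f n)) (ℚ.+-identityʳ 0ℚ)

⊛-zeroʳ : ∀ f → f ⊛ 0ˢ ≗ 0ˢ
⊛-zeroʳ f n = trans (⊛-comm f 0ˢ n) (⊛-zeroˡ f n)

#-⊛ : ∀ c f → # c ⊛ f ≗ fromℕ c • f
#-⊛ c f zero    = ℚ.+-identityʳ (fromℕ c ℚ.* f 0)
#-⊛ c f (suc n) = trans (cong (fromℕ c ℚ.* f (suc n) ℚ.+_) (⊛-zeroˡ f n))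
  (ℚ.+-identityʳ (fromℕ c ℚ.* f (suc n)))

X-⊛-suc : ∀ f n → (X ⊛ f) (suc n) ≡ f n
X-⊛-suc f n = begin
  0ℚ ℚ.* f (suc n) ℚ.+ ((X ∘ suc) ⊛ f) n
    ≡⟨ cong (0ℚ ℚ.* f (suc n) ℚ.+_) (trans (⊛-congʳ f X∘suc≗1 n) (#-⊛ 1 f n)) ⟩
  0ℚ ℚ.* f (suc n) ℚ.+ 1ℚ ℚ.* f n
    ≡⟨ solve 2 (λ a b → con 0ℚ :* a :+ con 1ℚ :* b := b) refl (f (suc n)) (f n) ⟩
  f n ∎
  where
  open ≡-Reasoning
  X∘suc≗1 : X ∘ suc ≗ # 1
  X∘suc≗1 zero    = refl
  X∘suc≗1 (suc _) = refl

⊖-as-⊕ : ∀ f g → f ⊖ g ≗ f ⊕ (ℚ.- 1ℚ) • g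
⊖-as-⊕ f g n = solve 2 (λ a b → a :- b := a :+ :- con 1ℚ :* b) refl (f n) (g n)

⊛-distribʳ-⊖ : ∀ f g h → (f ⊖ g) ⊛ h ≗ (f ⊛ h) ⊖ (g ⊛ h)
⊛-distribʳ-⊖ f g h n = begin
  ((f ⊖ g) ⊛ h) n                           ≡⟨ ⊛-congʳ h (⊖-as-⊕ f g) n ⟩
  ((f ⊕ (ℚ.- 1ℚ) • g) ⊛ h) n                ≡⟨ ⊛-distribʳ-⊕ f ((ℚ.- 1ℚ) • g) h n ⟩
  (f ⊛ h) n ℚ.+ (((ℚ.- 1ℚ) • g) ⊛ h) n      ≡⟨ cong ((f ⊛ h) n ℚ.+_) (⊛-•ˡ (ℚ.- 1ℚ) g h n) ⟩
  (f ⊛ h) n ℚ.+ (ℚ.- 1ℚ) ℚ.* (g ⊛ h) n      ≡⟨ ⊖-as-⊕ (f ⊛ h) (g ⊛ h) n ⟨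
  (f ⊛ h) n ℚ.- (g ⊛ h) n                   ∎
  where open ≡-Reasoning

[1-X]-suc : ∀ f n → ((# 1 ⊖ X) ⊛ f) (suc n) ≡ f (suc n) ℚ.- f n
[1-X]-suc f n = trans (⊛-distribʳ-⊖ (# 1) X f (suc n))
  (cong₂ ℚ._-_ (trans (#-⊛ 1 f (suc n)) (ℚ.*-identityˡ (f (suc n)))) (X-⊛-suc f n))

[1-cX]-suc : ∀ c f n → ((# 1 ⊖ # c ⊛ X) ⊛ f) (suc n) ≡ f (suc n) ℚ.- fromℕ c ℚ.* f n
[1-cX]-suc c f n = begin
  ((# 1 ⊖ # c ⊛ X) ⊛ f) (suc n)
    ≡⟨ ⊛-distribʳ-⊖ (# 1) (# c ⊛ X) f (suc n) ⟩
  (# 1 ⊛ f) (suc n) ℚ.- (# c ⊛ X ⊛ f) (suc n)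
    ≡⟨ cong₂ ℚ._-_ (trans (#-⊛ 1 f (suc n)) (ℚ.*-identityˡ (f (suc n))))
         (trans (⊛-assoc (# c) X f (suc n))
           (trans (#-⊛ c (X ⊛ f) (suc n)) (cong (fromℕ c ℚ.*_) (X-⊛-suc f n)))) ⟩
  f (suc n) ℚ.- fromℕ c ℚ.* f n ∎
  where open ≡-Reasoning

-- The derivation x d/dx.
θ : PowerSeries → PowerSeries
θ f n = fromℕ n ℚ.* f n

θ-cong : ∀ {f g} → f ≗ g → θ f ≗ θ g
θ-cong f≗g n = cong (fromℕ n ℚ.*_) (f≗g n)

θ-⊛ : ∀ f g → θ (f ⊛ g) ≗ (θ f ⊛ g) ⊕ (f ⊛ θ g)
θ-⊛ f g n = begin
  fromℕ n ℚ.* sum {suc n} (λ i → f (toℕ i) ℚ.* g (n ∸ toℕ i))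
    ≡⟨ *-distribˡ-sum {suc n} (fromℕ n) (λ i → f (toℕ i) ℚ.* g (n ∸ toℕ i)) ⟩
  sum {suc n} (λ i → fromℕ n ℚ.* (f (toℕ i) ℚ.* g (n ∸ toℕ i)))
    ≡⟨ sum-cong-≗ {suc n} termwise ⟩
  sum {suc n} (λ i → θ f (toℕ i) ℚ.* g (n ∸ toℕ i) ℚ.+ f (toℕ i) ℚ.* θ g (n ∸ toℕ i))
    ≡⟨ ∑-distrib-+ {suc n} (λ i → θ f (toℕ i) ℚ.* g (n ∸ toℕ i))
                           (λ i → f (toℕ i) ℚ.* θ g (n ∸ toℕ i)) ⟩
  (θ f ⊛ g) n ℚ.+ (f ⊛ θ g) n ∎
  where
  open ≡-Reasoning
  termwise : ∀ (i : Fin (suc n)) → fromℕ n ℚ.* (f (toℕ i) ℚ.* g (n ∸ toℕ i)) ≡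
    θ f (toℕ i) ℚ.* g (n ∸ toℕ i) ℚ.+ f (toℕ i) ℚ.* θ g (n ∸ toℕ i)
  termwise i = trans
    (cong (ℚ._* (f (toℕ i) ℚ.* g (n ∸ toℕ i)))
      (trans (cong fromℕ (sym (m+[n∸m]≡n (toℕ≤pred[n] i)))) (fromℕ-+ (toℕ i) (n ∸ toℕ i))))
    (solve 4 (λ i j a b → (i :+ j) :* (a :* b) := i :* a :* b :+ a :* (j :* b)) refl
      (fromℕ (toℕ i)) (fromℕ (n ∸ toℕ i)) (f (toℕ i)) (g (n ∸ toℕ i)))

-- For S² = F and ST = 1, the derivation θ gives θ(F) T + 2 F θ(T) = 0.
module _ (F S T : PowerSeries) (S²≗F : S ² ≗ F) (ST≗1 : S ⊛ T ≗ # 1) where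

  private
    θ[ST] : θ S ⊛ T ⊕ S ⊛ θ T ≗ 0ˢ
    θ[ST] n = trans (sym (θ-⊛ S T n)) (trans (θ-cong ST≗1 n) (θ1≗0 n))
      where
      θ1≗0 : θ (# 1) ≗ 0ˢ
      θ1≗0 zero    = refl
      θ1≗0 (suc n) = ℚ.*-zeroʳ (fromℕ (suc n))

    S⊛θ[ST] : S ⊛ (θ S ⊛ T) ⊕ F ⊛ θ T ≗ 0ˢ
    S⊛θ[ST] n = begin
      (S ⊛ (θ S ⊛ T)) n ℚ.+ (F ⊛ θ T) n
        ≡⟨ cong ((S ⊛ (θ S ⊛ T)) n ℚ.+_)
             (trans (⊛-congʳ (θ T) (λ k → sym (S²≗F k)) n) (⊛-assoc S S (θ T) n)) ⟩
      (S ⊛ (θ S ⊛ T)) n ℚ.+ (S ⊛ (S ⊛ θ T)) n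
        ≡⟨ ⊛-distribˡ-⊕ S (θ S ⊛ T) (S ⊛ θ T) n ⟨
      (S ⊛ (θ S ⊛ T ⊕ S ⊛ θ T)) n
        ≡⟨ trans (⊛-congˡ S θ[ST] n) (⊛-zeroʳ S n) ⟩
      0ℚ ∎
      where open ≡-Reasoning

    θF⊛T : θ F ⊛ T ≗ S ⊛ (θ S ⊛ T) ⊕ S ⊛ (θ S ⊛ T)
    θF⊛T n = begin
      (θ F ⊛ T) n
        ≡⟨ ⊛-congʳ T (λ k → trans (θ-cong (λ j → sym (S²≗F j)) k) (θ-⊛ S S k)) n ⟩
      ((θ S ⊛ S ⊕ S ⊛ θ S) ⊛ T) n
        ≡⟨ ⊛-congʳ T (λ k → cong (ℚ._+ (S ⊛ θ S) k) (⊛-comm (θ S) S k)) n ⟩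
      ((S ⊛ θ S ⊕ S ⊛ θ S) ⊛ T) n
        ≡⟨ ⊛-distribʳ-⊕ (S ⊛ θ S) (S ⊛ θ S) T n ⟩
      (S ⊛ θ S ⊛ T) n ℚ.+ (S ⊛ θ S ⊛ T) n
        ≡⟨ cong₂ ℚ._+_ (⊛-assoc S (θ S) T n) (⊛-assoc S (θ S) T n) ⟩
      (S ⊛ (θ S ⊛ T)) n ℚ.+ (S ⊛ (θ S ⊛ T)) n ∎
      where open ≡-Reasoning

  inverse-√-ode : ∀ n → (θ F ⊛ T) n ℚ.+ fromℕ 2 ℚ.* (F ⊛ θ T) n ≡ 0ℚ
  inverse-√-ode n = begin
    (θ F ⊛ T) n ℚ.+ fromℕ 2 ℚ.* (F ⊛ θ T) n
      ≡⟨ cong (ℚ._+ fromℕ 2 ℚ.* (F ⊛ θ T) n) (θF⊛T n) ⟩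
    s ℚ.+ s ℚ.+ fromℕ 2 ℚ.* (F ⊛ θ T) n
      ≡⟨ solve 2 (λ s t → s :+ s :+ con (fromℕ 2) :* t := con (fromℕ 2) :* (s :+ t)) refl
           s ((F ⊛ θ T) n) ⟩
    fromℕ 2 ℚ.* (s ℚ.+ (F ⊛ θ T) n)
      ≡⟨ cong (fromℕ 2 ℚ.*_) (S⊛θ[ST] n) ⟩
    fromℕ 2 ℚ.* 0ℚ
      ≡⟨⟩
    0ℚ ∎
    where
    open ≡-Reasoning
    s = (S ⊛ (θ S ⊛ T)) n

-- The generating function

θ[1-cX] : ∀ c → θ (# 1 ⊖ # c ⊛ X) ≗ (ℚ.- fromℕ c) • X
θ[1-cX] c n = trans
  (cong (λ t → fromℕ n ℚ.* ((# 1) n ℚ.- t)) (#-⊛ c X n)) (cases n)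
  where
  cases : ∀ n → fromℕ n ℚ.* ((# 1) n ℚ.- fromℕ c ℚ.* X n) ≡ ℚ.- fromℕ c ℚ.* X n
  cases zero = solve 1
    (λ c → con 0ℚ :* (con 1ℚ :- c :* con 0ℚ) := :- c :* con 0ℚ) refl (fromℕ c)
  cases (suc zero) = solve 1
    (λ c → con 1ℚ :* (con 0ℚ :- c :* con 1ℚ) := :- c :* con 1ℚ) refl (fromℕ c)
  cases (suc (suc n)) = solve 2
    (λ c n → n :* (con 0ℚ :- c :* con 0ℚ) := :- c :* con 0ℚ) refl (fromℕ c) (fromℕ (2 + n))

-- 1/√(1 - 4x) generates the central binomial coefficients: the differential
-- equation for T reads (n + 1) T(n+1) = (4n + 2) T(n) on coefficients.
inverse-√[1-4X] : ∀ S T → S ² ≗ # 1 ⊖ # 4 ⊛ X → S ⊛ T ≗ # 1 → S 0 ≡ 1ℚ →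
                  ∀ n → T n ≡ fromℕ (central n)
inverse-√[1-4X] S T S²≗F ST≗1 S₀≡1 zero = begin
  T 0                  ≡⟨ solve 1 (λ t → t := con 1ℚ :* t :+ con 0ℚ) refl (T 0) ⟩
  1ℚ ℚ.* T 0 ℚ.+ 0ℚ    ≡⟨ cong (λ s → s ℚ.* T 0 ℚ.+ 0ℚ) S₀≡1 ⟨
  (S ⊛ T) 0            ≡⟨ ST≗1 0 ⟩
  fromℕ 1              ∎
  where open ≡-Reasoning
inverse-√[1-4X] S T S²≗F ST≗1 S₀≡1 (suc n) =
  ℚ-*-cancelˡ (fromℕ (suc n)) {{fromℕ-nonZero (suc n)}} (begin
  fromℕ (suc n) ℚ.* T (suc n)
    -- Half the left side of the differential equation is split off.
    ≡⟨ solve 3 (λ a b c → b :=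
           (con ½ :* (:- con (fromℕ 4) :* a
                      :+ con (fromℕ 2) :* (b :- con (fromℕ 4) :* (c :* a)))
            :+ (con (fromℕ 4) :* c :+ con (fromℕ 2)) :* a))
         refl (T n) (fromℕ (suc n) ℚ.* T (suc n)) (fromℕ n) ⟩
  ½ ℚ.* (ℚ.- fromℕ 4 ℚ.* T n ℚ.+ fromℕ 2 ℚ.* (θ T (suc n) ℚ.- fromℕ 4 ℚ.* θ T n))
  ℚ.+ (fromℕ 4 ℚ.* fromℕ n ℚ.+ fromℕ 2) ℚ.* T n
    ≡⟨ cong (λ t → ½ ℚ.* t ℚ.+ (fromℕ 4 ℚ.* fromℕ n ℚ.+ fromℕ 2) ℚ.* T n) ode ⟩
  ½ ℚ.* 0ℚ ℚ.+ (fromℕ 4 ℚ.* fromℕ n ℚ.+ fromℕ 2) ℚ.* T n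
    ≡⟨ ℚ.+-identityˡ _ ⟩
  (fromℕ 4 ℚ.* fromℕ n ℚ.+ fromℕ 2) ℚ.* T n
    ≡⟨ cong₂ ℚ._*_ (sym (trans (fromℕ-+ (4 * n) 2) (cong (ℚ._+ fromℕ 2) (fromℕ-* 4 n))))
         (inverse-√[1-4X] S T S²≗F ST≗1 S₀≡1 n) ⟩
  fromℕ (4 * n + 2) ℚ.* fromℕ (central n)
    ≡⟨ fromℕ-* (4 * n + 2) (central n) ⟨
  fromℕ ((4 * n + 2) * central n)
    ≡⟨ cong fromℕ (central-recurrence n) ⟨
  fromℕ (suc n * central (suc n))
    ≡⟨ fromℕ-* (suc n) (central (suc n)) ⟩
  fromℕ (suc n) ℚ.* fromℕ (central (suc n)) ∎)
  where
  open ≡-Reasoning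
  F = # 1 ⊖ # 4 ⊛ X
  ode : ℚ.- fromℕ 4 ℚ.* T n ℚ.+ fromℕ 2 ℚ.* (θ T (suc n) ℚ.- fromℕ 4 ℚ.* θ T n) ≡ 0ℚ
  ode = begin
    ℚ.- fromℕ 4 ℚ.* T n ℚ.+ fromℕ 2 ℚ.* (θ T (suc n) ℚ.- fromℕ 4 ℚ.* θ T n)
      ≡⟨ cong₂ (λ s t → s ℚ.+ fromℕ 2 ℚ.* t)
           (trans (⊛-congʳ T (θ[1-cX] 4) (suc n))
             (trans (⊛-•ˡ (ℚ.- fromℕ 4) X T (suc n)) (cong (ℚ.- fromℕ 4 ℚ.*_) (X-⊛-suc T n))))
           ([1-cX]-suc 4 (θ T) n) ⟨
    (θ F ⊛ T) (suc n) ℚ.+ fromℕ 2 ℚ.* (F ⊛ θ T) (suc n)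
      ≡⟨ inverse-√-ode F S T S²≗F ST≗1 (suc n) ⟩
    0ℚ ∎

[1-3X]²-⊛ : ∀ f n → ((# 1 ⊖ # 3 ⊛ X) ² ⊛ f) (2 + n) ≡
            f (2 + n) ℚ.- fromℕ 6 ℚ.* f (1 + n) ℚ.+ fromℕ 9 ℚ.* f n
[1-3X]²-⊛ f n = begin
  (P ² ⊛ f) (2 + n)                                     ≡⟨ ⊛-assoc P P f (2 + n) ⟩
  (P ⊛ (P ⊛ f)) (2 + n)                                 ≡⟨ [1-cX]-suc 3 (P ⊛ f) (1 + n) ⟩
  (P ⊛ f) (2 + n) ℚ.- fromℕ 3 ℚ.* (P ⊛ f) (1 + n)
    ≡⟨ cong₂ (λ s t → s ℚ.- fromℕ 3 ℚ.* t) ([1-cX]-suc 3 f (1 + n)) ([1-cX]-suc 3 f n) ⟩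
  (f (2 + n) ℚ.- fromℕ 3 ℚ.* f (1 + n)) ℚ.- fromℕ 3 ℚ.* (f (1 + n) ℚ.- fromℕ 3 ℚ.* f n)
    ≡⟨ solve 3 (λ a b c → (a :- con (fromℕ 3) :* b) :- con (fromℕ 3) :* (b :- con (fromℕ 3) :* c)
                          := a :- con (fromℕ 6) :* b :+ con (fromℕ 9) :* c) refl
         (f (2 + n)) (f (1 + n)) (f n) ⟩
  f (2 + n) ℚ.- fromℕ 6 ℚ.* f (1 + n) ℚ.+ fromℕ 9 ℚ.* f n ∎
  where
  open ≡-Reasoning
  P = # 1 ⊖ # 3 ⊛ X

[1-3X][1-X]-⊛ : ∀ f n → ((# 1 ⊖ # 3 ⊛ X) ⊛ (# 1 ⊖ X) ⊛ f) (2 + n) ≡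
                f (2 + n) ℚ.- fromℕ 4 ℚ.* f (1 + n) ℚ.+ fromℕ 3 ℚ.* f n
[1-3X][1-X]-⊛ f n = begin
  (P ⊛ Q ⊛ f) (2 + n)                                   ≡⟨ ⊛-assoc P Q f (2 + n) ⟩
  (P ⊛ (Q ⊛ f)) (2 + n)                                 ≡⟨ [1-cX]-suc 3 (Q ⊛ f) (1 + n) ⟩
  (Q ⊛ f) (2 + n) ℚ.- fromℕ 3 ℚ.* (Q ⊛ f) (1 + n)
    ≡⟨ cong₂ (λ s t → s ℚ.- fromℕ 3 ℚ.* t) ([1-X]-suc f (1 + n)) ([1-X]-suc f n) ⟩
  (f (2 + n) ℚ.- f (1 + n)) ℚ.- fromℕ 3 ℚ.* (f (1 + n) ℚ.- f n)
    ≡⟨ solve 3 (λ a b c → (a :- b) :- con (fromℕ 3) :* (b :- c)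
                          := a :- con (fromℕ 4) :* b :+ con (fromℕ 3) :* c) refl
         (f (2 + n)) (f (1 + n)) (f n) ⟩
  f (2 + n) ℚ.- fromℕ 4 ℚ.* f (1 + n) ℚ.+ fromℕ 3 ℚ.* f n ∎
  where
  open ≡-Reasoning
  P = # 1 ⊖ # 3 ⊛ X
  Q = # 1 ⊖ X

-- The power series whose product with x^(-2) is the right-hand side.
x²R : PowerSeries
x²R = ((# 1 ⊖ # 3 ⊛ X) ² ⊛ inverse (# 2 ⊛ √ (# 1 ⊖ # 4 ⊛ X)))
  ⊖ ((# 1 ⊖ # 3 ⊛ X) ⊛ (# 1 ⊖ X) ⊛ inverse (# 2))

halve : ∀ {p q} → fromℕ 2 ℚ.* p ≡ q → p ≡ ½ ℚ.* q
halve {p} {q} 2p≡q = trans (solve 1 (λ p → p := con ½ :* (con (fromℕ 2) :* p)) refl p)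
  (cong (½ ℚ.*_) 2p≡q)

inverse-2√[1-4X] : ∀ n → inverse (# 2 ⊛ √ (# 1 ⊖ # 4 ⊛ X)) n ≡ ½ ℚ.* fromℕ (central n)
inverse-2√[1-4X] n = halve (trans (sym (#-⊛ 2 U n))
  (inverse-√[1-4X] S (# 2 ⊛ U) (√-correct F refl) S⊛2U≗1 refl n))
  where
  F = # 1 ⊖ # 4 ⊛ X
  S = √ F
  U = inverse (# 2 ⊛ S)
  S⊛2U≗1 : S ⊛ (# 2 ⊛ U) ≗ # 1
  S⊛2U≗1 k = begin
    (S ⊛ (# 2 ⊛ U)) k ≡⟨ ⊛-assoc S (# 2) U k ⟨
    (S ⊛ # 2 ⊛ U) k   ≡⟨ ⊛-congʳ U (⊛-comm S (# 2)) k ⟩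
    (# 2 ⊛ S ⊛ U) k   ≡⟨ inverse-correct (# 2 ⊛ S) k ⟩
    (# 1) k           ∎
    where open ≡-Reasoning

inverse-2 : ∀ n → inverse (# 2) n ≡ ½ ℚ.* (# 1) n
inverse-2 n = halve (trans (sym (#-⊛ 2 (inverse (# 2)) n)) (inverse-correct (# 2) n))

x²R-2+ : ∀ n → x²R (2 + n) ≡
  (½ ℚ.* fromℕ (central (2 + n)) ℚ.- fromℕ 6 ℚ.* (½ ℚ.* fromℕ (central (1 + n)))
   ℚ.+ fromℕ 9 ℚ.* (½ ℚ.* fromℕ (central n)))
  ℚ.- (½ ℚ.* 0ℚ ℚ.- fromℕ 4 ℚ.* (½ ℚ.* 0ℚ) ℚ.+ fromℕ 3 ℚ.* (½ ℚ.* (# 1) n))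
x²R-2+ n = cong₂ ℚ._-_
  (trans ([1-3X]²-⊛ (inverse (# 2 ⊛ √ (# 1 ⊖ # 4 ⊛ X))) n)
    (combine (fromℕ 6) (fromℕ 9)
      (inverse-2√[1-4X] (2 + n)) (inverse-2√[1-4X] (1 + n)) (inverse-2√[1-4X] n)))
  (trans ([1-3X][1-X]-⊛ (inverse (# 2)) n)
    (combine (fromℕ 4) (fromℕ 3) (inverse-2 (2 + n)) (inverse-2 (1 + n)) (inverse-2 n)))
  where
  combine : ∀ b c {x y z x′ y′ z′} → x ≡ x′ → y ≡ y′ → z ≡ z′ →
            x ℚ.- b ℚ.* y ℚ.+ c ℚ.* z ≡ x′ ℚ.- b ℚ.* y′ ℚ.+ c ℚ.* z′
  combine b c refl refl refl = refl

x²R-3+ : ∀ n → x²R (3 + n) ≡ fromℕ (∣I∣ n patterns)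
x²R-3+ n = begin
  x²R (3 + n)
    ≡⟨ x²R-2+ (1 + n) ⟩
  (½ ℚ.* c₃ ℚ.- fromℕ 6 ℚ.* (½ ℚ.* c₂) ℚ.+ fromℕ 9 ℚ.* (½ ℚ.* c₁))
  ℚ.- (½ ℚ.* 0ℚ ℚ.- fromℕ 4 ℚ.* (½ ℚ.* 0ℚ) ℚ.+ fromℕ 3 ℚ.* (½ ℚ.* 0ℚ))
    ≡⟨ solve 3 (λ a b c →
         (con ½ :* a :- con (fromℕ 6) :* (con ½ :* b) :+ con (fromℕ 9) :* (con ½ :* c))
         :- (con ½ :* con 0ℚ :- con (fromℕ 4) :* (con ½ :* con 0ℚ)
             :+ con (fromℕ 3) :* (con ½ :* con 0ℚ))
         := con ½ :* ((a :+ con (fromℕ 9) :* c) :- con (fromℕ 6) :* b)) refl c₃ c₂ c₁ ⟩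
  ½ ℚ.* ((c₃ ℚ.+ fromℕ 9 ℚ.* c₁) ℚ.- fromℕ 6 ℚ.* c₂)
    ≡⟨ cong (λ t → ½ ℚ.* (t ℚ.- fromℕ 6 ℚ.* c₂)) relation ⟨
  ½ ℚ.* ((fromℕ 2 ℚ.* i ℚ.+ fromℕ 6 ℚ.* c₂) ℚ.- fromℕ 6 ℚ.* c₂)
    ≡⟨ solve 2 (λ i b → con ½ :* ((con (fromℕ 2) :* i :+ b) :- b) := i) refl i (fromℕ 6 ℚ.* c₂) ⟩
  i ∎
  where
  open ≡-Reasoning
  i  = fromℕ (∣I∣ n patterns)
  c₁ = fromℕ (central (1 + n))
  c₂ = fromℕ (central (2 + n))
  c₃ = fromℕ (central (3 + n))
  relation : fromℕ 2 ℚ.* i ℚ.+ fromℕ 6 ℚ.* c₂ ≡ c₃ ℚ.+ fromℕ 9 ℚ.* c₁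
  relation = begin
    fromℕ 2 ℚ.* i ℚ.+ fromℕ 6 ℚ.* c₂
      ≡⟨ cong₂ ℚ._+_ (fromℕ-* 2 (∣I∣ n patterns)) (fromℕ-* 6 (central (2 + n))) ⟨
    fromℕ (2 * ∣I∣ n patterns) ℚ.+ fromℕ (6 * central (2 + n))
      ≡⟨ fromℕ-+ (2 * ∣I∣ n patterns) (6 * central (2 + n)) ⟨
    fromℕ (2 * ∣I∣ n patterns + 6 * central (2 + n))
      ≡⟨ cong fromℕ (∣I∣-central n) ⟩
    fromℕ (central (3 + n) + 9 * central (1 + n))
      ≡⟨ fromℕ-+ (central (3 + n)) (9 * central (1 + n)) ⟩
    c₃ ℚ.+ fromℕ (9 * central (1 + n))
      ≡⟨ cong (c₃ ℚ.+_) (fromℕ-* 9 (central (1 + n))) ⟩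
    c₃ ℚ.+ fromℕ 9 ℚ.* c₁ ∎

-- Laurent series

coeff-order+ : ∀ d f n → coeff (x^ d · f) (d ℤ.+ + n) ≡ f n
coeff-order+ d f n rewrite ℤ.+-comm d (+ n) | ℤ.+-assoc (+ n) d (ℤ.- d)
                         | ℤ.+-inverseʳ d | +-identityʳ n = refl

⊖ᴸ-sameOrder : ∀ d f g → x^ d · (f ⊖ g) ≈ᴸ (x^ d · f) ⊖ᴸ (x^ d · g)
⊖ᴸ-sameOrder d f g k rewrite ℤ.⊓-idem d with k ℤ.- d
... | + n      = sym (cong₂ ℚ._-_ (coeff-order+ d f n) (coeff-order+ d g n))
... | -[1+ _ ] = refl

-- If x³ divides h then x · (h / x³) = h / x².
shift₃ : ∀ {a h} → h 0 ≡ 0ℚ → h 1 ≡ 0ℚ → h 2 ≡ 0ℚ → (∀ n → h (3 + n) ≡ a n) →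
         x^ + 1 · a ≈ᴸ x^ -[1+ 1 ] · h
shift₃ {a} {h} h₀ h₁ h₂ h₃₊ (+ suc n) =
  sym (trans (cong h (cong suc (+-comm n 2))) (h₃₊ n))
shift₃ h₀ h₁ h₂ h₃₊ (+ 0)              = sym h₂
shift₃ h₀ h₁ h₂ h₃₊ -[1+ 0 ]           = sym h₁
shift₃ h₀ h₁ h₂ h₃₊ -[1+ 1 ]           = sym h₀
shift₃ h₀ h₁ h₂ h₃₊ -[1+ suc (suc _) ] = refl

theorem4p3 : ((x^ + 1 · λ n → fromℕ (∣I∣ n ((1 ∷ 0 ∷ 0 ∷ []) ∷ (0 ∷ 2 ∷ 1 ∷ []) ∷ [])))
    ≈ᴸ
    (x^ + 0 · (# 1 ⊖ # 3 ⊛ X) ²) ⊘ (x^ + 2 · # 2 ⊛ √ (# 1 ⊖ # 4 ⊛ X))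
    ⊖ᴸ
    (x^ + 0 · (# 1 ⊖ # 3 ⊛ X) ⊛ (# 1 ⊖ X)) ⊘ (x^ + 2 · # 2))
    ×
    (∀ (n : ℕ) →
    fromℕ (∣I∣ n ((1 ∷ 0 ∷ 0 ∷ []) ∷ (0 ∷ 2 ∷ 1 ∷ []) ∷ []))
    ≡ (+ (n * n + n + 6) ℚ./ (2 * (3 + n) * (2 + n)))
    ℚ.* fromℕ ((2 * n + 2) C (n + 1)))
theorem4p3 =
  (λ k → trans
    (shift₃ {λ n → fromℕ (∣I∣ n patterns)} {x²R} refl refl (x²R-2+ 0) x²R-3+ k)
    (⊖ᴸ-sameOrder -[1+ 1 ]
      ((# 1 ⊖ # 3 ⊛ X) ² ⊛ inverse (# 2 ⊛ √ (# 1 ⊖ # 4 ⊛ X)))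
      ((# 1 ⊖ # 3 ⊛ X) ⊛ (# 1 ⊖ X) ⊛ inverse (# 2)) k)) ,
  λ n → fromℕ-quotient {∣I∣ n patterns} {n * n + n + 6} {2 * (3 + n) * (2 + n)}
                       {(2 * n + 2) C (n + 1)} (∣I∣-closed n)
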